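{- For any totally positive $A\in\mathrm{SS}_n$ and any $I\subset[n]$ of even size, \[\operatorname{sgn}(\mathrm{Pf}_I(A))=(-1)^{\sum_{i\in I}i-\binom{|I|+1}{2}}.\] If $I=\{i_1<\cdots<i_{|I|}\}$ and $[n]\setminus I=\{j_1<\cdots<j_{n-|I|}\}$, this is the sign of the permutation $i_1,\dots,i_{|I|},j_1,\dots,j_{n-|I|}$ in one-line notation.
   Context: $\mathrm{SS}_n$ is the space of real skew-symmetric $n\times n$ matrices. For $I=\{i_1<\dots<i_{2m}\}\subset[n]$, $\mathrm{Pf}_I(A)=\frac{1}{2^mm!}\sum_{\sigma\in S_{2m}}\operatorname{sgn}(\sigma)\prod_{l=1}^m a_{i_{\sigma(2l-1)}i_{\sigma(2l)}}$, and $\mathrm{Pf}_\emptyset(A)=1$. Total positivity: let $N=\binom n2$, $E_{a,b}$ the $2n\times 2n$ matrix units, $x_i(t)=\mathrm{Id}_{2n}+tE_{i,i+1}-tE_{n+i+1,n+i}$ for $1\le i\le n-1$ and $x_n(t)=\mathrm{Id}_{2n}+tE_{n-1,2n}-tE_{n,2n-1}$. Let $(i_1,\dots,i_N)$ be the index sequence of the word $B_1B_2\cdots B_{\lfloor n/2\rfloor}$, $B_m=s_n(s_{n-2}s_{n-3}\cdots s_{2m-1})(s_{n-1}s_{n-2}\cdots s_{2m})$, descending products being empty when the starting index is less than the final one. For $t\in\mathbb{R}^N$, the first $n$ rows $X(t)$ of $x_{i_1}(t_1)\cdots x_{i_N}(t_N)$ have upper unitriangular left $n\times n$ block, so $X(t)$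 is row-equivalent to a unique $[\mathrm{Id}_n\mid A(t)]$ with $A(t)\in\mathrm{SS}_n$. $A\in\mathrm{SS}_n$ is totally positive if $A=A(t)$ for some $t\in\mathbb{R}^N_{>0}$. -}

module Defs where

open import Level using (0ℓ)
open import Data.Nat as ℕ using (ℕ; zero; suc; _∸_; _≤ᵇ_; _≡ᵇ_; ⌊_/2⌋; _^_; _!)
open import Data.Nat.Combinatorics using (_C_)
open import Data.Integer as ℤ using (ℤ; +_; ∣_∣)
open import Data.Fin using (Fin; toℕ; _↑ˡ_; _↑ʳ_)
open import Data.Fin.Subset using (Subset; ∁)
open import Data.Vec using (lookup)
open import Data.List as List using (List; []; _∷_; _++_; length; concatMap; applyUpTo; filter; allFin)
open import Data.Bool using (Bool; true; false; if_then_else_; T; _∧_)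
open import Data.Product using (Σ; _×_; _,_)
open import Data.Sum using (_⊎_)
open import Relation.Binary.PropositionalEquality using (_≡_; _≢_)
open import Relation.Nullary using (¬_)
open import Relation.Nullary.Decidable using (T?)

-- The real numbers, axiomatised as a (Dedekind-)complete ordered field.
-- Any model is (classically) isomorphic to ℝ.

record RealField : Set₁ where
  infixl 6 _+_ _-_
  infixl 7 _*_
  infix 4 _<_
  field
    Carrier : Set
    0# 1#   : Carrier
    _+_ _*_ : Carrier → Carrier → Carrier
    -_      : Carrier → Carrier
    _⁻¹     : Carrier → Carrier
    _<_     : Carrier → Carrier → Set
    +-assoc  : ∀ x y z → (x + y) + z ≡ x + (y + z)
    +-comm   : ∀ x y → x + y ≡ y + x
    +-idˡ    : ∀ x → 0# + x ≡ x
    -‿invˡ   : ∀ x → (- x) + x ≡ 0#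
    *-assoc  : ∀ x y z → (x * y) * z ≡ x * (y * z)
    *-comm   : ∀ x y → x * y ≡ y * x
    *-idˡ    : ∀ x → 1# * x ≡ x
    distribˡ : ∀ x y z → x * (y + z) ≡ (x * y) + (x * z)
    ⁻¹-invʳ  : ∀ x → x ≢ 0# → x * (x ⁻¹) ≡ 1#
    0≢1      : 0# ≢ 1#
    <-irrefl : ∀ x → ¬ (x < x)
    <-trans  : ∀ {x y z} → x < y → y < z → x < z
    <-tri    : ∀ x y → x < y ⊎ x ≡ y ⊎ y < x
    +-mono-< : ∀ {x y} z → x < y → x + z < y + z
    *-pos    : ∀ {x y} → 0# < x → 0# < y → 0# < x * y
    sup : ∀ (P : Carrier → Set) → Σ Carrier P →
          Σ Carrier (λ b → ∀ x → P x → ¬ (b < x)) →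
          Σ Carrier (λ s → (∀ x → P x → ¬ (s < x)) ×
                           (∀ b → (∀ x → P x → ¬ (b < x)) → ¬ (b < s)))

  _-_ : Carrier → Carrier → Carrier
  x - y = x + (- y)

module Reals (ℝ : RealField) where
  open RealField ℝ

  fromℕ : ℕ → Carrier
  fromℕ zero    = 0#
  fromℕ (suc k) = 1# + fromℕ k

  neg1^ : ℕ → Carrier
  neg1^ zero    = 1#
  neg1^ (suc k) = - neg1^ k

  Mat : ℕ → ℕ → Set
  Mat m n = Fin m → Fin n → Carrier

  sumFin : ∀ {n} → (Fin n → Carrier) → Carrier
  sumFin {zero}  f = 0#
  sumFin {suc n} f = f Fin.zero + sumFin (λ i → f (Fin.suc i))
    where import Data.Fin as Fin

  _⊗_ : ∀ {m k n} → Mat m k → Mat k n → Mat m n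
  (M ⊗ N) a b = sumFin (λ j → M a j * N j b)

  ind : Bool → Carrier
  ind true  = 1#
  ind false = 0#

  Id : ∀ {m} → Mat m m
  Id a b = ind (toℕ a ≡ᵇ toℕ b)

  -- entry test in 1-indexed coordinates: is (a , b) = (α , β) ?
  at : ∀ {m} → Fin m → Fin m → ℕ → ℕ → Carrier
  at a b α β = ind ((suc (toℕ a) ≡ᵇ α) ∧ (suc (toℕ b) ≡ᵇ β))

  xgen : (n i : ℕ) → Carrier → Mat (n ℕ.+ n) (n ℕ.+ n)
  xgen n i t a b with i ≡ᵇ n
  ... | false = Id a b + t * at a b i (suc i) - t * at a b (n ℕ.+ suc i) (n ℕ.+ i)
  ... | true  = Id a b + t * at a b (n ∸ 1) (n ℕ.+ n) - t * at a b n (n ℕ.+ n ∸ 1)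

  -- descending product s_a s_{a-1} ... s_b (empty if a < b)
  desc : ℕ → ℕ → List ℕ
  desc zero    b = if b ≤ᵇ 0 then 0 ∷ [] else []
  desc (suc a) b = if b ≤ᵇ suc a then suc a ∷ desc a b else []

  block : ℕ → ℕ → List ℕ
  block n m = n ∷ (desc (n ∸ 2) (2 ℕ.* m ∸ 1) ++ desc (n ∸ 1) (2 ℕ.* m))

  word : ℕ → List ℕ
  word n = concatMap (block n) (applyUpTo suc ⌊ n /2⌋)

  prodWord : (n : ℕ) (w : List ℕ) → (Fin (length w) → Carrier) → Mat (n ℕ.+ n) (n ℕ.+ n)
  prodWord n []      t = Id
  prodWord n (i ∷ w) t = xgen n i (t Fin.zero) ⊗ prodWord n w (λ k → t (Fin.suc k))
    where import Data.Fin as Fin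

  Params : ℕ → Set
  Params n = Fin (length (word n)) → Carrier

  Lblock Rblock : (n : ℕ) → Params n → Mat n n
  Lblock n t a b = prodWord n (word n) t (a ↑ˡ n) (b ↑ˡ n)
  Rblock n t a b = prodWord n (word n) t (a ↑ˡ n) (n ↑ʳ b)

  SkewSymmetric : ∀ {n} → Mat n n → Set
  SkewSymmetric A = ∀ a b → A a b ≡ - A b a

  -- A ∈ SS_n is totally positive: [L(t) | R(t)] is row-equivalent to
  -- [Id | A] for some t > 0, i.e. A = L(t)⁻¹ R(t), i.e. L(t) A = R(t).
  TotallyPositive : ∀ {n} → Mat n n → Set
  TotallyPositive {n} A =
    SkewSymmetric A ×
    Σ (Params n) (λ t → (∀ k → 0# < t k) × (∀ a b → (Lblock n t ⊗ A) a b ≡ Rblock n t a b))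

  elems : ∀ {n} → Subset n → List (Fin n)
  elems I = filter (λ i → T? (lookup I i)) (allFin _)

  insertions : ∀ {X : Set} → X → List X → List (List X)
  insertions x []       = (x ∷ []) ∷ []
  insertions x (y ∷ ys) = (x ∷ y ∷ ys) ∷ List.map (y ∷_) (insertions x ys)

  perms : ∀ {X : Set} → List X → List (List X)
  perms []       = [] ∷ []
  perms (x ∷ xs) = concatMap (insertions x) (perms xs)

  inversions : ∀ {n} → List (Fin n) → ℕ
  inversions []       = 0
  inversions (x ∷ xs) = List.length (filter (λ y → T? (suc (toℕ y) ≤ᵇ toℕ x)) xs) ℕ.+ inversions xs

  pairProd : ∀ {n} → Mat n n → List (Fin n) → Carrier
  pairProd A (a ∷ b ∷ r) = A a b * pairProd A r
  pairProd A _           = 1#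

  sumList : List Carrier → Carrier
  sumList = List.foldr _+_ 0#

  Pf : ∀ {n} → Subset n → Mat n n → Carrier
  Pf I A = (fromℕ (2 ^ m ℕ.* (m !))) ⁻¹ *
           sumList (List.map (λ σ → neg1^ (inversions σ) * pairProd A σ) (perms (elems I)))
    where m = ⌊ length (elems I) /2⌋

  HasSign : Carrier → ℤ → Set
  HasSign x s = (s ≡ ℤ.1ℤ × 0# < x) ⊎ (s ≡ ℤ.0ℤ × x ≡ 0#) ⊎ (s ≡ ℤ.-1ℤ × x < 0#)

neg1^ℤ : ℤ → ℤ
neg1^ℤ e = go ∣ e ∣
  where
  go : ℕ → ℤ
  go zero    = ℤ.1ℤ
  go (suc k) = ℤ.- go k

-- Σ_{i ∈ I} i  (1-indexed)
sumIdx : List ℕ → ℕ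
sumIdx = List.foldr ℕ._+_ 0

{-# OPTIONS --safe #-}
module Submission where

-- Up to row equivalence, multiplying [Id | A] on the right by a generator acts on A by a simple
-- move: x_i(t) with i < n subtracts t times row and column i + 1 from row and column i, and x_n(t)
-- adds t to a_{n-1,n}.  Put B_{ab} = -(-1)^{a+b} A_{ab}.  Then Pf_I(B) is (-1)^{Σ I - C(|I|+1,2)} Pf_I(A),
-- and the moves become subtraction-free:
--   x_i(t):  Pf_I ↦ Pf_I + t Pf_{I∖i∪{i+1}}   if i ∈ I and i + 1 ∉ I,
--   x_n(t):  Pf_I ↦ Pf_I + t Pf_{I∖{n-1,n}}   if n - 1, n ∈ I,
-- and Pf_I is unchanged otherwise.  Starting from B = 0, where Pf_∅ = 1, all Pf_I stay nonnegative and
-- never decrease.  Block B_m of the word creates the pair {n-1, n} and moves n - 1 down to i_{2m-1},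
-- then n down to i_{2m}, so after the whole word every Pf_I is positive.
-- Below, indices are 0-based natural numbers.

open import Defs
open import Level using (0ℓ)
open import Algebra.Bundles using (CommutativeRing)
import Algebra.Properties.Ring
import Algebra.Solver.Ring as RingSolver
open import Algebra.Solver.Ring.AlmostCommutativeRing using (AlmostCommutativeRing; fromCommutativeRing; _-Raw-AlmostCommutative⟶_)
open import Data.Bool using (Bool; true; false; if_then_else_; T; _∧_)
open import Data.Empty using (⊥-elim)
open import Data.Fin as Fin using (Fin; toℕ; _↑ˡ_; _↑ʳ_; fromℕ<; splitAt)
import Data.Fin.Properties as Finₚ
open import Data.Fin.Subset using (Subset; ∣_∣; ∁)
open import Data.Integer as ℤ using (ℤ; -[1+_]; _⊖_; _◃_)
import Data.Integer.Properties as ℤₚ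
open import Data.List using (List; []; _∷_; map; length; concatMap; _++_; applyUpTo; filter; tabulate; reverse; allFin)
open import Data.List.Properties using (map-++; map-∘; map-id-local; map-tabulate; length-map; unfold-reverse)
open import Data.List.Membership.Propositional using (_∈_; _∉_)
open import Data.List.Membership.Propositional.Properties using (∈-∃++)
open import Data.List.Relation.Binary.Permutation.Propositional as ↭ using (_↭_; ↭-sym; ↭-trans)
open import Data.List.Relation.Binary.Permutation.Propositional.Properties as ↭ₚ using (∈-resp-↭; All-resp-↭; ↭-length)
import Data.List.Relation.Binary.Permutation.Setoid.Properties as ↭ₛₚ
open import Data.List.Relation.Unary.All as All using (All; []; _∷_)
import Data.List.Relation.Unary.All.Properties as Allₚ
open import Data.List.Relation.Unary.AllPairs as AllPairs using (AllPairs; []; _∷_)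
import Data.List.Relation.Unary.AllPairs.Properties as AllPairsₚ
open import Data.List.Relation.Unary.Any using (here; there)
open import Data.List.Relation.Unary.Unique.Propositional using (Unique)
open import Data.Maybe using (Maybe; just; nothing)
open import Data.Nat as ℕ using (ℕ; zero; suc; _<ᵇ_; _≡ᵇ_; _≤ᵇ_; ⌊_/2⌋; _∸_; _!; _^_)
import Data.Nat.Properties as ℕₚ
open import Data.Nat.Combinatorics using (_C_; nC1≡n; nCk+nC[k+1]≡[n+1]C[k+1])
open import Data.Nat.Divisibility using (_∣_; divides)
open import Data.Nat.ListAction using (sum)
open import Data.Nat.ListAction.Properties using (sum-↭)
open import Data.Nat.Solver using (module +-*-Solver)
open import Data.Product using (_×_; _,_; ∃)
open import Data.Sign as Sign using (Sign)
open import Data.Sum using (_⊎_; inj₁; inj₂; map₂; [_,_]′)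
open import Data.Unit using (⊤; tt)
open import Data.Vec using ([]; _∷_; lookup)
open import Function using (_∘_)
open import Relation.Binary.PropositionalEquality
open import Relation.Nullary using (¬_; yes; no; contradiction)
open import Relation.Nullary.Decidable using (T?)
open import Algebra.Properties.CommutativeSemigroup ℕₚ.+-commutativeSemigroup using (x∙yz≈y∙xz)
open import Data.List.Membership.DecPropositional ℕ._≟_ using (_∈?_)

-- Ordered field arithmetic

-- The twist comes from conjugation by diag(1, -1, 1, ...): neighbouring indices get opposite signs,
-- so the subtraction in x_i becomes an addition, and the extra minus lets a_{n-1,n}, which x_n
-- raises, keep its sign. For |I| = 2m the twist multiplies Pf_I by (-1)^{Σ I + m}, and C(2m+1, 2) =
-- m + 2m² has the parity of m. No row reduction is carried out. Column c of A stacked on -e_c is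
-- annihilated by [L | R] because L A = R; stripping the generators from the left of the product
-- turns this equation, which concerns B = 0 at first, into one for the final B. The inverse of L
-- never appears. Positivity cannot be the invariant, since every Pf_I with I nonempty starts at 0.
-- Nonnegativity of all Pf_I is the invariant, and positivity is gained one size at a time: block m
-- obtains the sets of size 2m from those of size 2m - 2. Its descending runs may stop at 2m - 1 and
-- 2m because i_{2m-1} ≥ 2m - 1 and i_{2m} ≥ 2m.

module OrderedField (ℝ : RealField) where
  open RealField ℝ hiding (_-_)
  open Reals ℝ
  open ≡-Reasoning

  commutativeRing : CommutativeRing 0ℓ 0ℓ
  commutativeRing = record
    { Carrier = Carrier ; _≈_ = _≡_ ; _+_ = _+_ ; _*_ = _*_ ; -_ = -_ ; 0# = 0# ; 1# = 1#
    ; isCommutativeRing = record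
      { isRing = record
        { +-isAbelianGroup = record
          { isGroup = record
            { isMonoid = record
              { isSemigroup = record
                { isMagma = record { isEquivalence = isEquivalence ; ∙-cong = cong₂ _+_ }
                ; assoc = +-assoc }
              ; identity = +-idˡ , λ x → trans (+-comm x 0#) (+-idˡ x) }
            ; inverse = -‿invˡ , (λ x → trans (+-comm x (- x)) (-‿invˡ x))
            ; ⁻¹-cong = cong (-_) }
          ; comm = +-comm }
        ; *-cong = cong₂ _*_
        ; *-assoc = *-assoc
        ; *-identity = *-idˡ , λ x → trans (*-comm x 1#) (*-idˡ x)
        ; distrib = distribˡ , λ x y z → trans (*-comm (y + z) x)
                      (trans (distribˡ x y z) (cong₂ _+_ (*-comm x y) (*-comm x z))) }
      ; *-comm = *-comm } }

  open CommutativeRing commutativeRing public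
    using (ring; +-identityˡ; +-identityʳ; -‿inverseʳ; -‿inverseˡ; zeroˡ; zeroʳ; *-identityˡ; *-identityʳ; distribʳ)
  open Algebra.Properties.Ring ring public
    using (-‿distribˡ-*; -‿distribʳ-*; -0#≈0#; -‿+-comm; -‿involutive)

  fromℕ-+ : ∀ m n → fromℕ (m ℕ.+ n) ≡ fromℕ m + fromℕ n
  fromℕ-+ zero    n = sym (+-idˡ _)
  fromℕ-+ (suc m) n = trans (cong (1# +_) (fromℕ-+ m n)) (sym (+-assoc _ _ _))

  fromℕ-* : ∀ m n → fromℕ (m ℕ.* n) ≡ fromℕ m * fromℕ n
  fromℕ-* zero    n = sym (zeroˡ _)
  fromℕ-* (suc m) n = begin
    fromℕ (n ℕ.+ m ℕ.* n)          ≡⟨ fromℕ-+ n (m ℕ.* n) ⟩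
    fromℕ n + fromℕ (m ℕ.* n)      ≡⟨ cong₂ _+_ (sym (*-idˡ _)) (fromℕ-* m n) ⟩
    1# * fromℕ n + fromℕ m * fromℕ n ≡⟨ sym (distribʳ _ _ _) ⟩
    (1# + fromℕ m) * fromℕ n       ∎

  -- Equality in the abstract carrier does not compute, equality of integers does. The ring solver
  -- therefore takes integer coefficients, mapped in by this homomorphism, and can cancel terms.
  fromℤ : ℤ → Carrier
  fromℤ (ℤ.+ n)    = fromℕ n
  fromℤ -[1+ n ] = - fromℕ (suc n)

  fromℤ-⊖ : ∀ m n → fromℤ (m ⊖ n) ≡ fromℕ m + - fromℕ n
  fromℤ-⊖ m       zero    = sym (trans (cong (fromℕ m +_) -0#≈0#) (+-identityʳ _))
  fromℤ-⊖ zero    (suc n) = sym (+-idˡ _)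
  fromℤ-⊖ (suc m) (suc n) = begin
    fromℤ (suc m ⊖ suc n)                    ≡⟨ cong fromℤ (ℤₚ.[1+m]⊖[1+n]≡m⊖n m n) ⟩
    fromℤ (m ⊖ n)                            ≡⟨ fromℤ-⊖ m n ⟩
    fromℕ m + - fromℕ n                      ≡⟨ cong (_+ - fromℕ n) (sym (trans (cong (fromℕ m +_) (-‿inverseʳ 1#)) (+-identityʳ _))) ⟩
    (fromℕ m + (1# + - 1#)) + - fromℕ n      ≡⟨ cong (_+ - fromℕ n) (sym (+-assoc _ _ _)) ⟩
    ((fromℕ m + 1#) + - 1#) + - fromℕ n      ≡⟨ +-assoc _ _ _ ⟩
    (fromℕ m + 1#) + (- 1# + - fromℕ n)      ≡⟨ cong₂ _+_ (+-comm _ _) (-‿+-comm _ _) ⟩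
    fromℕ (suc m) + - fromℕ (suc n)          ∎

  fromℤ-+ : ∀ x y → fromℤ (x ℤ.+ y) ≡ fromℤ x + fromℤ y
  fromℤ-+ (ℤ.+ m)    (ℤ.+ n)    = fromℕ-+ m n
  fromℤ-+ (ℤ.+ m)    -[1+ n ] = fromℤ-⊖ m (suc n)
  fromℤ-+ -[1+ m ] (ℤ.+ n)    = trans (fromℤ-⊖ n (suc m)) (+-comm _ _)
  fromℤ-+ -[1+ m ] -[1+ n ] = trans (cong (λ k → - (1# + fromℕ k)) (sym (ℕₚ.+-suc m n)))
    (trans (cong (-_) (fromℕ-+ (suc m) (suc n))) (sym (-‿+-comm _ _)))

  fromℤ-neg : ∀ x → fromℤ (ℤ.- x) ≡ - fromℤ x
  fromℤ-neg (ℤ.+ zero)  = sym -0#≈0#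
  fromℤ-neg (ℤ.+ suc n) = refl
  fromℤ-neg -[1+ n ]  = sym (-‿involutive _)

  signed : Sign → Carrier → Carrier
  signed Sign.+ x = x
  signed Sign.- x = - x

  fromℤ-◃ : ∀ s n → fromℤ (s ◃ n) ≡ signed s (fromℕ n)
  fromℤ-◃ Sign.+ zero    = refl
  fromℤ-◃ Sign.- zero    = sym -0#≈0#
  fromℤ-◃ Sign.+ (suc n) = refl
  fromℤ-◃ Sign.- (suc n) = refl

  signed-* : ∀ s s′ x y → signed (s Sign.* s′) (x * y) ≡ signed s x * signed s′ y
  signed-* Sign.+ Sign.+ x y = refl
  signed-* Sign.+ Sign.- x y = -‿distribʳ-* x y
  signed-* Sign.- Sign.+ x y = -‿distribˡ-* x y
  signed-* Sign.- Sign.- x y = trans (sym (-‿involutive _))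
    (trans (cong (-_) (-‿distribˡ-* x y)) (-‿distribʳ-* (- x) y))

  fromℤ-* : ∀ x y → fromℤ (x ℤ.* y) ≡ fromℤ x * fromℤ y
  fromℤ-* x y = begin
    fromℤ ((sx Sign.* sy) ◃ (∣x∣ ℕ.* ∣y∣))          ≡⟨ fromℤ-◃ (sx Sign.* sy) (∣x∣ ℕ.* ∣y∣) ⟩
    signed (sx Sign.* sy) (fromℕ (∣x∣ ℕ.* ∣y∣))      ≡⟨ cong (signed (sx Sign.* sy)) (fromℕ-* ∣x∣ ∣y∣) ⟩
    signed (sx Sign.* sy) (fromℕ ∣x∣ * fromℕ ∣y∣)    ≡⟨ signed-* sx sy _ _ ⟩
    signed sx (fromℕ ∣x∣) * signed sy (fromℕ ∣y∣)    ≡⟨ sym (cong₂ _*_ (decompose x) (decompose y)) ⟩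
    fromℤ x * fromℤ y                                ∎
    where
    sx = ℤ.sign x
    sy = ℤ.sign y
    ∣x∣ = ℤ.∣ x ∣
    ∣y∣ = ℤ.∣ y ∣
    decompose : ∀ z → fromℤ z ≡ signed (ℤ.sign z) (fromℕ ℤ.∣ z ∣)
    decompose (ℤ.+ n)    = refl
    decompose -[1+ n ] = refl

  almostCommutativeRing : AlmostCommutativeRing 0ℓ 0ℓ
  almostCommutativeRing = fromCommutativeRing commutativeRing

  fromℤ-morphism : CommutativeRing.rawRing ℤₚ.+-*-commutativeRing -Raw-AlmostCommutative⟶ almostCommutativeRing
  fromℤ-morphism = record
    { ⟦_⟧ = fromℤ ; +-homo = fromℤ-+ ; *-homo = fromℤ-* ; -‿homo = fromℤ-neg
    ; 0-homo = refl ; 1-homo = +-identityʳ 1# }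

  fromℤ-≟ : ∀ x y → Maybe (fromℤ x ≡ fromℤ y)
  fromℤ-≟ x y with x ℤ.≟ y
  ... | yes eq = just (cong fromℤ eq)
  ... | no  _  = nothing

  module Solver = RingSolver (CommutativeRing.rawRing ℤₚ.+-*-commutativeRing)
    almostCommutativeRing fromℤ-morphism fromℤ-≟
  open Solver public using (solve; _:=_; _:+_; _:*_; :-_; con; Polynomial)

  :0 : ∀ {n} → Polynomial n
  :0 = con (ℤ.+ 0)

  neg1^-+ : ∀ m n → neg1^ (m ℕ.+ n) ≡ neg1^ m * neg1^ n
  neg1^-+ zero    n = sym (*-idˡ _)
  neg1^-+ (suc m) n = trans (cong (-_) (neg1^-+ m n)) (-‿distribˡ-* _ _)

  neg1^-square : ∀ m → neg1^ m * neg1^ m ≡ 1#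
  neg1^-square zero    = *-idˡ _
  neg1^-square (suc m) = trans (solve 1 (λ x → (:- x) :* (:- x) := x :* x) refl (neg1^ m)) (neg1^-square m)

  Nonneg : Carrier → Set
  Nonneg x = 0# < x ⊎ x ≡ 0#

  +-pos-nonneg : ∀ {x y} → 0# < x → Nonneg y → 0# < x + y
  +-pos-nonneg {x} {y} 0<x (inj₁ 0<y) =
    <-trans 0<y (subst (_< x + y) (+-idˡ y) (+-mono-< y 0<x))
  +-pos-nonneg {x} 0<x (inj₂ refl) = subst (0# <_) (sym (+-identityʳ x)) 0<x

  +-nonneg-pos : ∀ {x y} → Nonneg x → 0# < y → 0# < x + y
  +-nonneg-pos {x} {y} 0≤x 0<y = subst (0# <_) (+-comm y x) (+-pos-nonneg 0<y 0≤x)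

  +-nonneg : ∀ {x y} → Nonneg x → Nonneg y → Nonneg (x + y)
  +-nonneg (inj₁ 0<x)  0≤y = inj₁ (+-pos-nonneg 0<x 0≤y)
  +-nonneg (inj₂ refl) 0≤y = subst Nonneg (sym (+-idˡ _)) 0≤y

  *-pos-nonneg : ∀ {x y} → 0# < x → Nonneg y → Nonneg (x * y)
  *-pos-nonneg 0<x (inj₁ 0<y)  = inj₁ (*-pos 0<x 0<y)
  *-pos-nonneg 0<x (inj₂ refl) = inj₂ (zeroʳ _)

  neg⇒-pos : ∀ {x} → x < 0# → 0# < - x
  neg⇒-pos {x} x<0 = subst₂ _<_ (-‿inverseʳ x) (+-idˡ (- x)) (+-mono-< (- x) x<0)

  -pos⇒neg : ∀ {x} → 0# < - x → x < 0#
  -pos⇒neg {x} 0<-x = subst₂ _<_ (+-idˡ x) (-‿invˡ x) (+-mono-< x 0<-x)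

  0<1 : 0# < 1#
  0<1 with <-tri 0# 1#
  ... | inj₁ 0<1        = 0<1
  ... | inj₂ (inj₁ 0≡1) = ⊥-elim (0≢1 0≡1)
  ... | inj₂ (inj₂ 1<0) = subst (0# <_) (neg1^-square 1)
                            (*-pos (neg⇒-pos 1<0) (neg⇒-pos 1<0))

  fromℕ-pos : ∀ n → 0# < fromℕ (suc n)
  fromℕ-pos zero    = +-pos-nonneg 0<1 (inj₂ refl)
  fromℕ-pos (suc n) = +-pos-nonneg 0<1 (inj₁ (fromℕ-pos n))

  ⁻¹-pos : ∀ {x} → 0# < x → 0# < x ⁻¹
  ⁻¹-pos {x} 0<x with <-tri 0# (x ⁻¹)
  ... | inj₁ 0<x⁻¹ = 0<x⁻¹
  ... | inj₂ (inj₁ 0≡x⁻¹) = ⊥-elim (0≢1 (begin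
    0#         ≡⟨ sym (zeroʳ x) ⟩
    x * 0#     ≡⟨ cong (x *_) 0≡x⁻¹ ⟩
    x * x ⁻¹   ≡⟨ x*x⁻¹≡1 ⟩
    1#         ∎))
    where x*x⁻¹≡1 = ⁻¹-invʳ x (λ { refl → <-irrefl _ 0<x })
  ... | inj₂ (inj₂ x⁻¹<0) = ⊥-elim (<-irrefl 0# (<-trans 0<1 (-pos⇒neg
    (subst (0# <_) (trans (sym (-‿distribʳ-* _ _)) (cong (-_) x*x⁻¹≡1)) (*-pos 0<x (neg⇒-pos x⁻¹<0))))))
    where x*x⁻¹≡1 = ⁻¹-invʳ x (λ { refl → <-irrefl _ 0<x })

  -- Characteristic different from 2, read off the order. It makes sums that change sign under a
  -- transposition vanish, and also the diagonals of skew matrices.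
  x≡-x⇒x≡0 : ∀ {x} → x ≡ - x → x ≡ 0#
  x≡-x⇒x≡0 {x} x≡-x with <-tri 0# x
  ... | inj₁ 0<x = ⊥-elim (<-irrefl 0# (<-trans 0<x (-pos⇒neg (subst (0# <_) x≡-x 0<x))))
  ... | inj₂ (inj₁ 0≡x) = sym 0≡x
  ... | inj₂ (inj₂ x<0) = ⊥-elim (<-irrefl 0# (<-trans (subst (0# <_) (sym x≡-x) (neg⇒-pos x<0)) x<0))

-- Inversions

∉⇒All≢ : ∀ {x : ℕ} {xs} → x ∉ xs → All (_≢ x) xs
∉⇒All≢ {xs = []}     x∉ = []
∉⇒All≢ {xs = y ∷ xs} x∉ = (λ y≡x → x∉ (here (sym y≡x))) ∷ ∉⇒All≢ (x∉ ∘ there)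

All≢⇒∉ : ∀ {x : ℕ} {xs} → All (x ≢_) xs → x ∉ xs
All≢⇒∉ (x≢y ∷ _)   (here refl) = x≢y refl
All≢⇒∉ (_ ∷ x≢ys) (there x∈)  = All≢⇒∉ x≢ys x∈

smaller : ℕ → List ℕ → ℕ
smaller x []       = 0
smaller x (y ∷ ys) = (if y <ᵇ x then 1 else 0) ℕ.+ smaller x ys

inversionCount : List ℕ → ℕ
inversionCount []       = 0
inversionCount (x ∷ xs) = smaller x xs ℕ.+ inversionCount xs

<ᵇ-true : ∀ {m n} → m ℕ.< n → (m <ᵇ n) ≡ true
<ᵇ-true {m} {n} m<n with m <ᵇ n | ℕₚ.<⇒<ᵇ m<n
... | true | _ = refl

<ᵇ-false : ∀ {m n} → ¬ (m ℕ.< n) → (m <ᵇ n) ≡ false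
<ᵇ-false {m} {n} m≮n with m <ᵇ n in eq
... | false = refl
... | true  = contradiction (ℕₚ.<ᵇ⇒< m n (subst T (sym eq) tt)) m≮n

<ᵇ-cong : ∀ {a b c d} → (a ℕ.< b → c ℕ.< d) → (b ℕ.≤ a → d ℕ.≤ c) → (c <ᵇ d) ≡ (a <ᵇ b)
<ᵇ-cong {a} {b} to from with a ℕ.<? b
... | yes a<b = trans (<ᵇ-true (to a<b)) (sym (<ᵇ-true a<b))
... | no  a≮b = trans (<ᵇ-false (ℕₚ.≤⇒≯ (from (ℕₚ.≮⇒≥ a≮b)))) (sym (<ᵇ-false a≮b))

-- The threshold `x′` need not be `g x`: when a transposition moves the head of a list, the tail has
-- to be compared with a shifted threshold.
smaller-map : ∀ (g : ℕ → ℕ) {x x′} ys → All (λ y → (g y <ᵇ x′) ≡ (y <ᵇ x)) ys →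
              smaller x′ (map g ys) ≡ smaller x ys
smaller-map g []       []         = refl
smaller-map g (y ∷ ys) (eq ∷ eqs) =
  cong₂ (λ b k → (if b then 1 else 0) ℕ.+ k) eq (smaller-map g ys eqs)

inversionCount-map : ∀ (g : ℕ → ℕ) {P : ℕ → Set} →
  (∀ {x y} → P x → P y → y ℕ.< x → g y ℕ.< g x) →
  ∀ xs → All P xs → inversionCount (map g xs) ≡ inversionCount xs
inversionCount-map g mono []       []         = refl
inversionCount-map g mono (x ∷ xs) (px ∷ pxs) = cong₂ ℕ._+_
  (smaller-map g xs (All.map (λ py → <ᵇ-cong (mono px py) (weak px py)) pxs))
  (inversionCount-map g mono xs pxs)
  where
  weak : ∀ {x y} → _ → _ → x ℕ.≤ y → g x ℕ.≤ g y
  weak {x} {y} px py x≤y with ℕₚ.m≤n⇒m<n∨m≡n x≤y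
  ... | inj₁ x<y  = ℕₚ.<⇒≤ (mono py px x<y)
  ... | inj₂ refl = ℕₚ.≤-refl

smaller-suc-∉ : ∀ {x} ys → x ∉ ys → smaller (suc x) ys ≡ smaller x ys
smaller-suc-∉ []       x∉ = refl
smaller-suc-∉ {x} (y ∷ ys) x∉ = cong₂ (λ b k → (if b then 1 else 0) ℕ.+ k)
  (<ᵇ-cong {y} {x} ℕₚ.m<n⇒m<1+n (λ x≤y → ℕₚ.≤∧≢⇒< x≤y (x∉ ∘ here)))
  (smaller-suc-∉ ys (x∉ ∘ there))

smaller-suc-∈ : ∀ {x} ys → Unique ys → x ∈ ys → smaller (suc x) ys ≡ suc (smaller x ys)
smaller-suc-∈ {x} (.x ∷ ys) (x≢ys ∷ _) (here refl)
  rewrite <ᵇ-true (ℕₚ.n<1+n x) | <ᵇ-false (ℕₚ.<-irrefl {x} refl) =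
  cong suc (smaller-suc-∉ ys (All≢⇒∉ x≢ys))
smaller-suc-∈ {x} (y ∷ ys) (y≢ys ∷ u) (there x∈) = trans
  (cong₂ (λ b k → (if b then 1 else 0) ℕ.+ k)
    (<ᵇ-cong {y} {x} ℕₚ.m<n⇒m<1+n
      (λ x≤y → ℕₚ.≤∧≢⇒< x≤y (λ x≡y → All.lookup y≢ys x∈ (sym x≡y))))
    (smaller-suc-∈ ys u x∈))
  (ℕₚ.+-suc _ _)

transposition : ℕ → ℕ → ℕ
transposition i x with x ℕ.≟ i | x ℕ.≟ suc i
... | yes _ | _     = suc i
... | no  _ | yes _ = i
... | no  _ | no  _ = x

transposition-i : ∀ i → transposition i i ≡ suc i
transposition-i i with i ℕ.≟ i
... | yes _  = refl
... | no i≢i = contradiction refl i≢i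

transposition-1+i : ∀ i → transposition i (suc i) ≡ i
transposition-1+i i with suc i ℕ.≟ i | suc i ℕ.≟ suc i
... | yes eq | _     = contradiction eq ℕₚ.1+n≢n
... | no _   | yes _ = refl
... | no _   | no ne = contradiction refl ne

transposition-fix : ∀ {i x} → x ≢ i → x ≢ suc i → transposition i x ≡ x
transposition-fix {i} {x} x≢i x≢1+i with x ℕ.≟ i | x ℕ.≟ suc i
... | yes eq | _      = contradiction eq x≢i
... | no _   | yes eq = contradiction eq x≢1+i
... | no _   | no _   = refl

data Position (i : ℕ) : ℕ → Set where
  first  : Position i i
  second : Position i (suc i)
  other  : ∀ {x} → x ≢ i → x ≢ suc i → Position i x

position : ∀ i x → Position i x
position i x with x ℕ.≟ i | x ℕ.≟ suc i
... | yes refl | _        = first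
... | no _     | yes refl = second
... | no x≢i   | no x≢1+i = other x≢i x≢1+i

transposition-map-fix : ∀ {i} xs → i ∉ xs → suc i ∉ xs → map (transposition i) xs ≡ xs
transposition-map-fix xs i∉ 1+i∉ = map-id-local
  (All.zipWith (λ (x≢i , x≢1+i) → transposition-fix x≢i x≢1+i) (∉⇒All≢ i∉ , ∉⇒All≢ 1+i∉))

-- An adjacent transposition reverses the order of one pair only, `i` and `suc i`. Excluding either
-- of them makes it strictly monotone.
transposition-mono-≢i : ∀ {i x y} → x ≢ i → y ≢ i → y ℕ.< x → transposition i y ℕ.< transposition i x
transposition-mono-≢i {i} {x} {y} x≢i y≢i y<x with position i x | position i y
... | first          | _     = contradiction refl x≢i
... | _              | first = contradiction refl y≢i
... | second         | second = contradiction y<x (ℕₚ.<-irrefl refl)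
... | second         | other _ y≢1+i rewrite transposition-1+i i | transposition-fix y≢i y≢1+i =
  ℕₚ.≤∧≢⇒< (ℕ.s≤s⁻¹ y<x) y≢i
... | other _ x≢1+i  | second rewrite transposition-1+i i | transposition-fix x≢i x≢1+i = ℕₚ.<-trans (ℕₚ.n<1+n i) y<x
... | other _ x≢1+i  | other _ y≢1+i rewrite transposition-fix y≢i y≢1+i | transposition-fix x≢i x≢1+i = y<x

transposition-mono-≢1+i : ∀ {i x y} → x ≢ suc i → y ≢ suc i → y ℕ.< x → transposition i y ℕ.< transposition i x
transposition-mono-≢1+i {i} {x} {y} x≢1+i y≢1+i y<x with position i x | position i y
... | second         | _      = contradiction refl x≢1+i
... | _              | second = contradiction refl y≢1+i
... | first          | first  = contradiction y<x (ℕₚ.<-irrefl refl)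
... | first          | other y≢i _ rewrite transposition-i i | transposition-fix y≢i y≢1+i = ℕₚ.m<n⇒m<1+n y<x
... | other x≢i _    | first rewrite transposition-i i | transposition-fix x≢i x≢1+i =
  ℕₚ.≤∧≢⇒< y<x (x≢1+i ∘ sym)
... | other x≢i _    | other y≢i _ rewrite transposition-fix y≢i y≢1+i | transposition-fix x≢i x≢1+i = y<x

inversionCount-transposition-∉ : ∀ {i} xs → suc i ∉ xs →
  inversionCount (map (transposition i) xs) ≡ inversionCount xs
inversionCount-transposition-∉ {i} xs 1+i∉ =
  inversionCount-map (transposition i) {_≢ suc i} transposition-mono-≢1+i xs (∉⇒All≢ 1+i∉)

tail-∈ : ∀ {x y : ℕ} {xs} → y ≢ x → y ∈ x ∷ xs → y ∈ xs
tail-∈ y≢x (here y≡x) = contradiction y≡x y≢x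
tail-∈ y≢x (there y∈) = y∈

transposition-<ᵇ : ∀ {i x} → x ≢ i → x ≢ suc i → ∀ y → (transposition i y <ᵇ x) ≡ (y <ᵇ x)
transposition-<ᵇ {i} {x} x≢i x≢1+i y with position i y
... | first rewrite transposition-i i =
  <ᵇ-cong {i} {x} (λ i<x → ℕₚ.≤∧≢⇒< i<x (x≢1+i ∘ sym)) (λ x≤i → ℕₚ.≤-trans x≤i (ℕₚ.n≤1+n i))
... | second rewrite transposition-1+i i =
  <ᵇ-cong {suc i} {x} (ℕₚ.<-trans (ℕₚ.n<1+n i)) (λ x≤1+i → ℕ.s≤s⁻¹ (ℕₚ.≤∧≢⇒< x≤1+i x≢1+i))
... | other y≢i y≢1+i rewrite transposition-fix y≢i y≢1+i = refl

-- Either direction changes the parity, which is all that the sign needs; the direction depends on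
-- which of `i` and `suc i` comes first.
data FlipsBy1 (m n : ℕ) : Set where
  up   : m ≡ suc n → FlipsBy1 m n
  down : n ≡ suc m → FlipsBy1 m n

-- Any other entry compares in the same way with `i` and with `suc i`, so only the inversion between
-- these two appears or disappears. The recursion ends at the first of the two.
inversionCount-transposition : ∀ {i} xs → Unique xs → i ∈ xs → suc i ∈ xs →
  FlipsBy1 (inversionCount (map (transposition i) xs)) (inversionCount xs)
inversionCount-transposition {i} (x ∷ xs) (x≢xs ∷ u) i∈ 1+i∈ with position i x
inversionCount-transposition {i} (.i ∷ xs) (i≢xs ∷ u) _ (here eq) | first = contradiction eq ℕₚ.1+n≢n
inversionCount-transposition {i} (.i ∷ xs) (i≢xs ∷ u) _ (there 1+i∈) | first
  rewrite transposition-i i = up (cong₂ ℕ._+_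
    -- As `i` is not in the tail, what lands below `suc i` is what was below `suc (suc i)`. Lowering
    -- this threshold to `i` then loses exactly the entry `suc i`: this is the one extra inversion.
    (trans (smaller-map (transposition i) {suc (suc i)} xs (All.map below (∉⇒All≢ i∉)))
      (trans (smaller-suc-∈ xs u 1+i∈) (cong suc (smaller-suc-∉ xs i∉))))
    (inversionCount-map (transposition i) {_≢ i} transposition-mono-≢i xs (∉⇒All≢ i∉)))
  where
  i∉ = All≢⇒∉ i≢xs
  below : ∀ {y} → y ≢ i → (transposition i y <ᵇ suc i) ≡ (y <ᵇ suc (suc i))
  below {y} y≢i with position i y
  ... | first = contradiction refl y≢i
  ... | second rewrite transposition-1+i i = refl
  ... | other _ y≢1+i rewrite transposition-fix y≢i y≢1+i =
    <ᵇ-cong {y} {suc (suc i)} (λ y<2+i → ℕₚ.≤∧≢⇒< (ℕ.s≤s⁻¹ y<2+i) y≢1+i) (ℕₚ.≤-trans (ℕₚ.n≤1+n _))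
inversionCount-transposition {i} (.(suc i) ∷ xs) (1+i≢xs ∷ u) (here eq) _ | second = contradiction (sym eq) ℕₚ.1+n≢n
inversionCount-transposition {i} (.(suc i) ∷ xs) (1+i≢xs ∷ u) (there i∈) _ | second
  rewrite transposition-1+i i = down (trans
    (cong₂ ℕ._+_ (smaller-suc-∈ xs u i∈) refl)
    (cong suc (sym (cong₂ ℕ._+_
      (smaller-map (transposition i) {i} xs (All.map below (∉⇒All≢ 1+i∉)))
      (inversionCount-transposition-∉ xs 1+i∉)))))
  where
  1+i∉ = All≢⇒∉ 1+i≢xs
  below : ∀ {y} → y ≢ suc i → (transposition i y <ᵇ i) ≡ (y <ᵇ i)
  below {y} y≢1+i with position i y
  ... | first rewrite transposition-i i = trans (<ᵇ-false {suc i} {i} (ℕₚ.<⇒≯ (ℕₚ.n<1+n i))) (sym (<ᵇ-false {i} {i} (ℕₚ.<-irrefl refl)))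
  ... | second = contradiction refl y≢1+i
  ... | other y≢i _ rewrite transposition-fix y≢i y≢1+i = refl
inversionCount-transposition {i} (x ∷ xs) (x≢xs ∷ u) i∈ 1+i∈ | other x≢i x≢1+i
  rewrite transposition-fix x≢i x≢1+i
        | smaller-map (transposition i) {x} {x} xs (All.universal (transposition-<ᵇ x≢i x≢1+i) xs)
  with inversionCount-transposition xs u (tail-∈ (x≢i ∘ sym) i∈) (tail-∈ (x≢1+i ∘ sym) 1+i∈)
... | up eq   = up (trans (cong (smaller x xs ℕ.+_) eq) (ℕₚ.+-suc _ _))
... | down eq = down (trans (cong (smaller x xs ℕ.+_) eq) (ℕₚ.+-suc _ _))

-- Sums over permutations

Unique-resp-↭ : ∀ {xs ys : List ℕ} → xs ↭ ys → Unique xs → Unique ys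
Unique-resp-↭ p = ↭ₛₚ.Unique-resp-↭ (setoid ℕ) (↭.↭⇒↭ₛ p)

∈⇒↭ : ∀ {x : ℕ} {xs} → x ∈ xs → ∃ λ ys → xs ↭ x ∷ ys
∈⇒↭ {x} x∈ with ∈-∃++ x∈
... | ys , zs , refl = ys ++ zs , ↭ₚ.shift x ys zs

-- Brought to the front, `i` and `suc i` are swapped, and the remaining entries are fixed by
-- uniqueness.
transposition-↭ : ∀ {i} xs → Unique xs → i ∈ xs → suc i ∈ xs → xs ↭ map (transposition i) xs
transposition-↭ {i} xs u i∈ 1+i∈ with ∈⇒↭ i∈
... | ys , xs↭ with ∈⇒↭ (tail-∈ ℕₚ.1+n≢n (∈-resp-↭ xs↭ 1+i∈)) | Unique-resp-↭ xs↭ u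
... | zs , ys↭ | u₁ with Unique-resp-↭ (↭.prep i ys↭) u₁
... | (_ ∷ i≢zs) ∷ (1+i≢zs ∷ _) = ↭-trans xs↭′ (↭-trans (↭.swap i (suc i) ↭.refl)
      (↭-trans (↭.↭-reflexive (sym mapped)) (↭ₚ.map⁺ (transposition i) (↭-sym xs↭′))))
  where
  xs↭′ : xs ↭ i ∷ suc i ∷ zs
  xs↭′ = ↭-trans xs↭ (↭.prep i ys↭)
  mapped : map (transposition i) (i ∷ suc i ∷ zs) ≡ suc i ∷ i ∷ zs
  mapped = cong₂ _∷_ (transposition-i i) (cong₂ _∷_ (transposition-1+i i)
    (transposition-map-fix zs (All≢⇒∉ i≢zs) (All≢⇒∉ 1+i≢zs)))

-- Evenness in a form that can be matched on two entries at a time, as `matching` consumes its list.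
data EvenLength {X : Set} : List X → Set where
  []  : EvenLength []
  ∷∷_ : ∀ {a b r} → EvenLength r → EvenLength (a ∷ b ∷ r)

evenLength : ∀ {X : Set} m (l : List X) → length l ≡ m ℕ.* 2 → EvenLength l
evenLength zero    []          eq = []
evenLength (suc m) (a ∷ b ∷ r) eq = ∷∷ evenLength m r (ℕₚ.suc-injective (ℕₚ.suc-injective eq))

module Pfaffian (ℝ : RealField) where
  open RealField ℝ hiding (_-_)
  open Reals ℝ
  open OrderedField ℝ
  open ≡-Reasoning

  module _ {X : Set} where
    -- `insΣ` and `permΣ` are the sums over `insertions` and `perms` with the intermediate lists
    -- fused away, so that linearity and congruence are direct inductions. `sumList-perms` is the
    -- link back.
    insΣ : X → List X → (List X → Carrier) → Carrier
    insΣ x []       f = f (x ∷ [])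
    insΣ x (y ∷ ys) f = f (x ∷ y ∷ ys) + insΣ x ys (λ σ → f (y ∷ σ))

    permΣ : List X → (List X → Carrier) → Carrier
    permΣ []       f = f []
    permΣ (x ∷ xs) f = permΣ xs (λ τ → insΣ x τ f)

    insΣ-cong : ∀ x l {f g} → (∀ σ → σ ↭ x ∷ l → f σ ≡ g σ) → insΣ x l f ≡ insΣ x l g
    insΣ-cong x []       f≗g = f≗g _ ↭.refl
    insΣ-cong x (y ∷ ys) f≗g = cong₂ _+_ (f≗g _ ↭.refl)
      (insΣ-cong x ys (λ σ p → f≗g (y ∷ σ) (↭-trans (↭.prep y p) (↭.swap y x ↭.refl))))

    -- The proof of `σ ↭ l` handed to the summands is what carries length, uniqueness and membership
    -- from the index list to each arrangement.
    permΣ-cong : ∀ l {f g} → (∀ σ → σ ↭ l → f σ ≡ g σ) → permΣ l f ≡ permΣ l g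
    permΣ-cong []       f≗g = f≗g [] ↭.refl
    permΣ-cong (x ∷ xs) f≗g = permΣ-cong xs (λ τ p → insΣ-cong x τ (λ σ q → f≗g σ (↭-trans q (↭.prep x p))))

    insΣ-+ : ∀ x l f g → insΣ x l (λ σ → f σ + g σ) ≡ insΣ x l f + insΣ x l g
    insΣ-+ x []       f g = refl
    insΣ-+ x (y ∷ ys) f g = trans (cong (_ +_) (insΣ-+ x ys _ _))
      (solve 4 (λ a b c d → (a :+ b) :+ (c :+ d) := (a :+ c) :+ (b :+ d)) refl _ _ _ _)

    permΣ-+ : ∀ l f g → permΣ l (λ σ → f σ + g σ) ≡ permΣ l f + permΣ l g
    permΣ-+ []       f g = refl
    permΣ-+ (x ∷ xs) f g = trans (permΣ-cong xs (λ τ _ → insΣ-+ x τ f g)) (permΣ-+ xs _ _)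

    insΣ-* : ∀ x l c f → insΣ x l (λ σ → c * f σ) ≡ c * insΣ x l f
    insΣ-* x []       c f = refl
    insΣ-* x (y ∷ ys) c f = trans (cong (_ +_) (insΣ-* x ys c _)) (sym (distribˡ _ _ _))

    permΣ-* : ∀ l c f → permΣ l (λ σ → c * f σ) ≡ c * permΣ l f
    permΣ-* []       c f = refl
    permΣ-* (x ∷ xs) c f = trans (permΣ-cong xs (λ τ _ → insΣ-* x τ c f)) (permΣ-* xs c _)

    insΣ-0 : ∀ x l {f} → (∀ σ → σ ↭ x ∷ l → f σ ≡ 0#) → insΣ x l f ≡ 0#
    insΣ-0 x l f≗0 = trans (insΣ-cong x l (λ σ p → trans (f≗0 σ p) (sym (zeroˡ 0#))))
      (trans (insΣ-* x l 0# (λ _ → 0#)) (zeroˡ _))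

    -- Both sides run over all placements of `x` and `y` in the list. Placements with both behind
    -- the head `a` agree by induction; the others are matched after expansion. This is the swap
    -- case of `permΣ-↭`.
    insΣ-comm : ∀ x y l f → insΣ y l (λ τ → insΣ x τ f) ≡ insΣ x l (λ τ → insΣ y τ f)
    insΣ-comm x y []      f = +-comm _ _
    insΣ-comm x y (a ∷ l) f = trans (expand x y) (trans
      (trans (cong (λ z → f (x ∷ y ∷ a ∷ l) + A + (B + z)) (insΣ-comm x y l (λ σ → f (a ∷ σ))))
        (solve 5 (λ p q c d z → (p :+ (q :+ c)) :+ (d :+ z) := (q :+ (p :+ d)) :+ (c :+ z)) refl _ _ _ _ _))
      (sym (expand y x)))
      where
      A = f (y ∷ x ∷ a ∷ l) + insΣ x l (λ σ → f (y ∷ a ∷ σ))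
      B = insΣ y l (λ σ → f (x ∷ a ∷ σ))
      expand : ∀ x y → insΣ y (a ∷ l) (λ τ → insΣ x τ f) ≡
        (f (x ∷ y ∷ a ∷ l) + (f (y ∷ x ∷ a ∷ l) + insΣ x l (λ σ → f (y ∷ a ∷ σ))))
        + (insΣ y l (λ σ → f (x ∷ a ∷ σ)) + insΣ y l (λ τ → insΣ x τ (λ σ → f (a ∷ σ))))
      expand x y = cong (insΣ x (y ∷ a ∷ l) f +_) (insΣ-+ y l _ _)

    permΣ-↭ : ∀ {l l′} → l ↭ l′ → ∀ f → permΣ l f ≡ permΣ l′ f
    permΣ-↭ ↭.refl         f = refl
    permΣ-↭ (↭.prep x p)   f = permΣ-↭ p _
    permΣ-↭ (↭.swap {ys = ys} x y p) f = trans (permΣ-↭ p _) (permΣ-cong ys (λ τ _ → insΣ-comm x y τ f))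
    permΣ-↭ (↭.trans p q)  f = trans (permΣ-↭ p f) (permΣ-↭ q f)

    sumList-++ : ∀ xs ys → sumList (xs ++ ys) ≡ sumList xs + sumList ys
    sumList-++ []       ys = sym (+-idˡ _)
    sumList-++ (x ∷ xs) ys = trans (cong (x +_) (sumList-++ xs ys)) (sym (+-assoc _ _ _))

    sumList-concatMap : ∀ {Y : Set} (f : X → Carrier) (g : Y → List X) ys →
      sumList (map f (concatMap g ys)) ≡ sumList (map (λ y → sumList (map f (g y))) ys)
    sumList-concatMap f g []       = refl
    sumList-concatMap f g (y ∷ ys) = trans (cong sumList (map-++ f (g y) (concatMap g ys)))
      (trans (sumList-++ (map f (g y)) _) (cong (_ +_) (sumList-concatMap f g ys)))

  module _ {X : Set} where
    sumList-insertions : ∀ (x : X) l f → sumList (map f (insertions x l)) ≡ insΣ x l f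
    sumList-insertions x []       f = +-identityʳ _
    sumList-insertions x (y ∷ ys) f = cong (_ +_)
      (trans (cong sumList (sym (map-∘ (insertions x ys)))) (sumList-insertions x ys _))

    sumList-perms : ∀ (l : List X) f → sumList (map f (perms l)) ≡ permΣ l f
    sumList-perms []       f = +-identityʳ _
    sumList-perms (x ∷ xs) f = begin
      sumList (map f (concatMap (insertions x) (perms xs)))               ≡⟨ sumList-concatMap f (insertions x) (perms xs) ⟩
      sumList (map (λ τ → sumList (map f (insertions x τ))) (perms xs))   ≡⟨ sumList-perms xs _ ⟩
      permΣ xs (λ τ → sumList (map f (insertions x τ)))                   ≡⟨ permΣ-cong xs (λ τ _ → sumList-insertions x τ f) ⟩
      permΣ xs (λ τ → insΣ x τ f)                                         ∎

  module _ {X Y : Set} (g : X → Y) where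
    insΣ-map : ∀ x l f → insΣ (g x) (map g l) f ≡ insΣ x l (λ σ → f (map g σ))
    insΣ-map x []       f = refl
    insΣ-map x (y ∷ ys) f = cong (_ +_) (insΣ-map x ys _)

    permΣ-map : ∀ l f → permΣ (map g l) f ≡ permΣ l (λ σ → f (map g σ))
    permΣ-map []       f = refl
    permΣ-map (x ∷ xs) f = trans (permΣ-map xs _) (permΣ-cong xs (λ τ _ → insΣ-map x τ f))

  -- Pfaffians on index lists, and the shear moves

  Matrix : Set
  Matrix = ℕ → ℕ → Carrier

  matching : Matrix → List ℕ → Carrier
  matching B (a ∷ b ∷ r) = B a b * matching B r
  matching B _           = 1#

  sgn : List ℕ → Carrier
  sgn σ = neg1^ (inversionCount σ)

  -- the Pfaffian, up to the positive factor 2ᵐ m!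
  pf : Matrix → List ℕ → Carrier
  pf B l = permΣ l (λ σ → sgn σ * matching B σ)

  -- `sgn` counts inversions by value and not relative to `l`, so the list merely names the index
  -- set, and the index that moves may always be brought to the front.
  pf-↭ : ∀ B {l l′} → l ↭ l′ → pf B l ≡ pf B l′
  pf-↭ B p = permΣ-↭ p _

  δ : ℕ → ℕ → Carrier
  δ a b = ind (a ≡ᵇ b)

  δ-refl : ∀ a → δ a a ≡ 1#
  δ-refl zero    = refl
  δ-refl (suc a) = δ-refl a

  δ-≢ : ∀ {a b} → a ≢ b → δ a b ≡ 0#
  δ-≢ {a} {b} a≢b with a ≡ᵇ b in eq
  ... | false = refl
  ... | true  = contradiction (ℕₚ.≡ᵇ⇒≡ a b (subst T (sym eq) tt)) a≢b

  -- The congruence by 1 + t E_{i,i+1}, without its quadratic term t² B_{i+1,i+1} in the entry (i,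
  -- i); that term vanishes for skew `B`.
  shear : ℕ → Carrier → Matrix → Matrix
  shear i t B a b = B a b + t * (δ a i * B (suc i) b) + t * (δ b i * B a (suc i))

  shear-≢ : ∀ {i t B a b} → a ≢ i → b ≢ i → shear i t B a b ≡ B a b
  shear-≢ {i} {t} {B} {a} {b} a≢i b≢i rewrite δ-≢ a≢i | δ-≢ b≢i =
    solve 4 (λ x t y z → x :+ t :* (:0 :* y) :+ t :* (:0 :* z) := x) refl _ _ _ _

  shear-row : ∀ {i t B b} → b ≢ i → shear i t B i b ≡ B i b + t * B (suc i) b
  shear-row {i} {t} {B} {b} b≢i rewrite δ-refl i | δ-≢ b≢i | *-idˡ (B (suc i) b) =
    solve 4 (λ x t y z → x :+ t :* y :+ t :* (:0 :* z) := x :+ t :* y) refl _ _ _ _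

  shear-col : ∀ {i t B a} → a ≢ i → shear i t B a i ≡ B a i + t * B a (suc i)
  shear-col {i} {t} {B} {a} a≢i rewrite δ-refl i | δ-≢ a≢i | *-idˡ (B a (suc i)) =
    solve 4 (λ x t y z → x :+ t :* (:0 :* z) :+ t :* y := x :+ t :* y) refl _ _ _ _

  -- The new term of a shear reads index `suc i` in place of `i`, a replacement and not an exchange,
  -- so `suc i` may occur twice afterwards. Comparing it with `transposition` separates the two
  -- cases: equal to it when `suc i` is absent, invariant under it when both are present.
  raise : ℕ → ℕ → ℕ
  raise i x with x ℕ.≟ i
  ... | yes _ = suc i
  ... | no  _ = x

  raise-i : ∀ i → raise i i ≡ suc i
  raise-i i with i ℕ.≟ i
  ... | yes _  = refl
  ... | no i≢i = contradiction refl i≢i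

  raise-≢ : ∀ {i x} → x ≢ i → raise i x ≡ x
  raise-≢ {i} {x} x≢i with x ℕ.≟ i
  ... | yes eq = contradiction eq x≢i
  ... | no  _  = refl

  raise-transposition : ∀ i x → raise i (transposition i x) ≡ raise i x
  raise-transposition i x with position i x
  ... | first = trans (cong (raise i) (transposition-i i)) (trans (raise-≢ ℕₚ.1+n≢n) (sym (raise-i i)))
  ... | second = trans (cong (raise i) (transposition-1+i i)) (trans (raise-i i) (sym (raise-≢ ℕₚ.1+n≢n)))
  ... | other x≢i x≢1+i = cong (raise i) (transposition-fix x≢i x≢1+i)

  raise≡transposition : ∀ {i x} → x ≢ suc i → raise i x ≡ transposition i x
  raise≡transposition {i} {x} x≢1+i with position i x
  ... | first = trans (raise-i i) (sym (transposition-i i))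
  ... | second = contradiction refl x≢1+i
  ... | other x≢i _ = trans (raise-≢ x≢i) (sym (transposition-fix x≢i x≢1+i))

  map-raise-∉ : ∀ {i} xs → i ∉ xs → map (raise i) xs ≡ xs
  map-raise-∉ []       i∉ = refl
  map-raise-∉ (x ∷ xs) i∉ = cong₂ _∷_ (raise-≢ (λ x≡i → i∉ (here (sym x≡i)))) (map-raise-∉ xs (i∉ ∘ there))

  map-raise-transposition : ∀ i xs → map (raise i) (map (transposition i) xs) ≡ map (raise i) xs
  map-raise-transposition i []       = refl
  map-raise-transposition i (x ∷ xs) = cong₂ _∷_ (raise-transposition i x) (map-raise-transposition i xs)

  map-raise≡map-transposition : ∀ {i} xs → suc i ∉ xs → map (raise i) xs ≡ map (transposition i) xs
  map-raise≡map-transposition []       1+i∉ = refl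
  map-raise≡map-transposition (x ∷ xs) 1+i∉ = cong₂ _∷_
    (raise≡transposition (λ x≡1+i → 1+i∉ (here (sym x≡1+i)))) (map-raise≡map-transposition xs (1+i∉ ∘ there))

  matching-shear-∉ : ∀ {i t B} σ → i ∉ σ → matching (shear i t B) σ ≡ matching B σ
  matching-shear-∉ []          i∉ = refl
  matching-shear-∉ (a ∷ [])    i∉ = refl
  matching-shear-∉ {i} {t} {B} (a ∷ b ∷ r) i∉ = cong₂ _*_
    (shear-≢ {i} {t} {B} (λ a≡i → i∉ (here (sym a≡i))) (λ b≡i → i∉ (there (here (sym b≡i)))))
    (matching-shear-∉ r (i∉ ∘ there ∘ there))

  -- By uniqueness `i` lies in exactly one factor of the product, so no higher power of `t` arises.
  matching-shear-∈ : ∀ {i t B σ} → EvenLength σ → Unique σ → i ∈ σ →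
    matching (shear i t B) σ ≡ matching B σ + t * matching B (map (raise i) σ)
  matching-shear-∈ {i} {t} {B} {a ∷ b ∷ r} (∷∷ ev) ((a≢b ∷ a≢r) ∷ (b≢r ∷ u)) i∈ with a ℕ.≟ i
  ... | yes refl
    rewrite shear-row {i} {t} {B} (a≢b ∘ sym) | raise-≢ (a≢b ∘ sym) | matching-shear-∉ {i} {t} {B} r (All≢⇒∉ a≢r)
          | map-raise-∉ r (All≢⇒∉ a≢r) =
    solve 4 (λ x t y m → (x :+ t :* y) :* m := x :* m :+ t :* (y :* m)) refl _ _ _ _
  ... | no a≢i with b ℕ.≟ i
  ... | yes refl
    rewrite shear-col {i} {t} {B} a≢i | matching-shear-∉ {i} {t} {B} r (All≢⇒∉ b≢r)
          | map-raise-∉ r (All≢⇒∉ b≢r) =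
    solve 4 (λ x t y m → (x :+ t :* y) :* m := x :* m :+ t :* (y :* m)) refl _ _ _ _
  ... | no b≢i
    rewrite shear-≢ {i} {t} {B} a≢i b≢i
          | matching-shear-∈ {i} {t} {B} ev u (tail-∈ (b≢i ∘ sym) (tail-∈ (a≢i ∘ sym) i∈)) =
    solve 4 (λ x t m m′ → x :* (m :+ t :* m′) := x :* m :+ t :* (x :* m′)) refl _ _ _ _

  module _ {m : ℕ} {l : List ℕ} (∣l∣ : length l ≡ m ℕ.* 2) (u : Unique l) where

    evenLength-↭ : ∀ {σ} → σ ↭ l → EvenLength σ
    evenLength-↭ p = evenLength m _ (trans (↭-length p) ∣l∣)

    pf-shear-∉ : ∀ {i t B} → i ∉ l → pf (shear i t B) l ≡ pf B l
    pf-shear-∉ i∉ = permΣ-cong l (λ σ p → cong (sgn σ *_) (matching-shear-∉ σ (i∉ ∘ ∈-resp-↭ p)))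

    pf-shear-raise : ∀ {i t B} → i ∈ l →
      pf (shear i t B) l ≡ pf B l + t * permΣ l (λ σ → sgn σ * matching B (map (raise i) σ))
    pf-shear-raise {i} {t} {B} i∈ = begin
      pf (shear i t B) l
        ≡⟨ permΣ-cong l (λ σ p → trans
             (cong (sgn σ *_) (matching-shear-∈ {i} {t} {B} (evenLength-↭ p) (Unique-resp-↭ (↭-sym p) u) (∈-resp-↭ (↭-sym p) i∈)))
             (solve 4 (λ s x t y → s :* (x :+ t :* y) := s :* x :+ t :* (s :* y)) refl _ _ _ _)) ⟩
      permΣ l (λ σ → sgn σ * matching B σ + t * (sgn σ * matching B (map (raise i) σ)))
        ≡⟨ permΣ-+ l _ _ ⟩
      pf B l + permΣ l (λ σ → t * (sgn σ * matching B (map (raise i) σ)))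
        ≡⟨ cong (pf B l +_) (permΣ-* l t _) ⟩
      pf B l + t * permΣ l (λ σ → sgn σ * matching B (map (raise i) σ)) ∎

    -- With `suc i` absent, `raise` acts as the transposition, which is monotone on these lists;
    -- inversions survive and the raised sum is again a Pfaffian.
    pf-shear-move : ∀ {i t B} → i ∈ l → suc i ∉ l →
      pf (shear i t B) l ≡ pf B l + t * pf B (map (transposition i) l)
    pf-shear-move {i} {t} {B} i∈ 1+i∉ = trans (pf-shear-raise i∈) (cong (λ z → pf B l + t * z) (begin
      permΣ l (λ σ → sgn σ * matching B (map (raise i) σ))
        ≡⟨ permΣ-cong l (λ σ p → sym (cong₂ _*_
             (cong neg1^ (inversionCount-transposition-∉ σ (1+i∉ ∘ ∈-resp-↭ p)))
             (cong (matching B) (sym (map-raise≡map-transposition σ (1+i∉ ∘ ∈-resp-↭ p)))))) ⟩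
      permΣ l (λ σ → sgn (map (transposition i) σ) * matching B (map (transposition i) σ))
        ≡⟨ sym (permΣ-map (transposition i) l _) ⟩
      pf B (map (transposition i) l) ∎))

    sgn-transposition : ∀ {i σ} → Unique σ → i ∈ σ → suc i ∈ σ → sgn (map (transposition i) σ) ≡ - sgn σ
    sgn-transposition {i} {σ} u i∈ 1+i∈ with inversionCount-transposition σ u i∈ 1+i∈
    ... | up eq   = cong neg1^ eq
    ... | down eq = trans (sym (-‿involutive _)) (cong (-_) (sym (cong neg1^ eq)))

    -- two equal rows: the transposition of i and i + 1 reverses every sign
    pf-shear-both : ∀ {i t B} → i ∈ l → suc i ∈ l → pf (shear i t B) l ≡ pf B l
    pf-shear-both {i} {t} {B} i∈ 1+i∈ = trans (pf-shear-raise i∈) (trans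
      (cong (λ z → pf B l + t * z) (x≡-x⇒x≡0 antisymmetric))
      (solve 2 (λ x t → x :+ t :* :0 := x) refl _ _))
      where
      term : List ℕ → Carrier
      term σ = sgn σ * matching B (map (raise i) σ)
      antisymmetric : permΣ l term ≡ - permΣ l term
      antisymmetric = begin
        permΣ l term                                      ≡⟨ permΣ-↭ (transposition-↭ l u i∈ 1+i∈) term ⟩
        permΣ (map (transposition i) l) term              ≡⟨ permΣ-map (transposition i) l term ⟩
        permΣ l (λ σ → term (map (transposition i) σ))
          ≡⟨ permΣ-cong l (λ σ p → trans
               (cong₂ _*_ (sgn-transposition (Unique-resp-↭ (↭-sym p) u) (∈-resp-↭ (↭-sym p) i∈) (∈-resp-↭ (↭-sym p) 1+i∈))
                          (cong (matching B) (map-raise-transposition i σ)))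
               (trans (sym (-‿distribˡ-* _ _)) (trans (cong (-_) (sym (*-idˡ _))) (-‿distribˡ-* _ _)))) ⟩
        permΣ l (λ σ → (- 1#) * term σ)                   ≡⟨ permΣ-* l (- 1#) term ⟩
        (- 1#) * permΣ l term                             ≡⟨ trans (sym (-‿distribˡ-* _ _)) (cong (-_) (*-idˡ _)) ⟩
        - permΣ l term                                    ∎

-- Pfaffians under the pair-creating move

smaller-↭ : ∀ x {ys zs} → ys ↭ zs → smaller x ys ≡ smaller x zs
smaller-↭ x ↭.refl         = refl
smaller-↭ x (↭.prep y p)   = cong (_ ℕ.+_) (smaller-↭ x p)
smaller-↭ x (↭.swap y z p) rewrite smaller-↭ x p =
  x∙yz≈y∙xz (if y <ᵇ x then 1 else 0) (if z <ᵇ x then 1 else 0) _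
smaller-↭ x (↭.trans p q)  = trans (smaller-↭ x p) (smaller-↭ x q)

smaller-max : ∀ {x} ys → All (ℕ._< x) ys → smaller x ys ≡ length ys
smaller-max []       []           = refl
smaller-max (y ∷ ys) (y<x ∷ ys<x) rewrite <ᵇ-true y<x = cong suc (smaller-max ys ys<x)

smaller-> : ∀ {x y} ys → x ℕ.≤ y → smaller x (y ∷ ys) ≡ smaller x ys
smaller-> {x} {y} ys x≤y rewrite <ᵇ-false {y} {x} (ℕₚ.≤⇒≯ x≤y) = refl

All<⇒∉ : ∀ {x} {xs} → All (ℕ._< x) xs → x ∉ xs
All<⇒∉ (y<x ∷ _) (here refl) = ℕₚ.<-irrefl refl y<x
All<⇒∉ (_ ∷ ys<x) (there x∈) = All<⇒∉ ys<x x∈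

module Bump (ℝ : RealField) where
  open RealField ℝ hiding (_-_)
  open Reals ℝ
  open OrderedField ℝ
  open Pfaffian ℝ
  open ≡-Reasoning

  skewUnit : ℕ → Matrix
  skewUnit k a b = δ a k * δ b (suc k) + - (δ a (suc k) * δ b k)

  bump : ℕ → Carrier → Matrix → Matrix
  bump k t B a b = B a b + t * skewUnit k a b

  -- the derivative of the matching product along skewUnit k
  ∂matching : ℕ → Matrix → List ℕ → Carrier
  ∂matching k B (a ∷ b ∷ r) = skewUnit k a b * matching B r + B a b * ∂matching k B r
  ∂matching k B _           = 0#

  module _ {k : ℕ} where

    skewUnit-≢k : ∀ {a b} → a ≢ k → b ≢ k → skewUnit k a b ≡ 0#
    skewUnit-≢k {a} {b} a≢k b≢k rewrite δ-≢ a≢k | δ-≢ b≢k =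
      solve 2 (λ x y → :0 :* x :+ :- (y :* :0) := :0) refl _ _

    skewUnit-≢1+k : ∀ {a b} → a ≢ suc k → b ≢ suc k → skewUnit k a b ≡ 0#
    skewUnit-≢1+k {a} {b} a≢1+k b≢1+k rewrite δ-≢ a≢1+k | δ-≢ b≢1+k =
      solve 2 (λ x y → x :* :0 :+ :- (:0 :* y) := :0) refl _ _

    skewUnit-k-1+k : skewUnit k k (suc k) ≡ 1#
    skewUnit-k-1+k rewrite δ-refl k | δ-≢ (ℕₚ.1+n≢n {k} ∘ sym) | *-idˡ 1# | zeroˡ (δ (suc k) k) | -0#≈0# = +-identityʳ _

    skewUnit-1+k-k : skewUnit k (suc k) k ≡ - 1#
    skewUnit-1+k-k rewrite δ-refl k | δ-≢ (ℕₚ.1+n≢n {k}) | *-idˡ 1# | zeroˡ (δ k (suc k)) = +-idˡ _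

    ∂matching-∷∷ : ∀ {B a b r} → skewUnit k a b ≡ 0# → ∂matching k B r ≡ 0# → ∂matching k B (a ∷ b ∷ r) ≡ 0#
    ∂matching-∷∷ {B} {a} {b} {r} e d rewrite e | d = solve 2 (λ x y → :0 :* x :+ y :* :0 := :0) refl _ _

    ∂matching-k∉ : ∀ {B} σ → k ∉ σ → ∂matching k B σ ≡ 0#
    ∂matching-k∉ []          k∉ = refl
    ∂matching-k∉ (_ ∷ [])    k∉ = refl
    ∂matching-k∉ {B} (a ∷ b ∷ r) k∉ = ∂matching-∷∷ {B} {a} {b} {r}
      (skewUnit-≢k (λ a≡k → k∉ (here (sym a≡k))) (λ b≡k → k∉ (there (here (sym b≡k)))))
      (∂matching-k∉ r (k∉ ∘ there ∘ there))

    ∂matching-1+k∉ : ∀ {B} σ → suc k ∉ σ → ∂matching k B σ ≡ 0#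
    ∂matching-1+k∉ []          k∉ = refl
    ∂matching-1+k∉ (_ ∷ [])    k∉ = refl
    ∂matching-1+k∉ {B} (a ∷ b ∷ r) k∉ = ∂matching-∷∷ {B} {a} {b} {r}
      (skewUnit-≢1+k (λ a≡k → k∉ (here (sym a≡k))) (λ b≡k → k∉ (there (here (sym b≡k)))))
      (∂matching-1+k∉ r (k∉ ∘ there ∘ there))

    -- The expansion in `t` stops at first order: a pair on which `skewUnit` does not vanish uses up
    -- `k`, and without `k` the derivative of the remaining pairs is zero.
    matching-bump : ∀ {t B} σ → Unique σ → matching (bump k t B) σ ≡ matching B σ + t * ∂matching k B σ
    matching-bump []       u = solve 2 (λ o t → o := o :+ t :* :0) refl _ _
    matching-bump (_ ∷ []) u = solve 2 (λ o t → o := o :+ t :* :0) refl _ _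
    matching-bump {t} {B} (a ∷ b ∷ r) ((_ ∷ a≢r) ∷ (b≢r ∷ u)) = begin
      (B a b + t * e) * matching (bump k t B) r
        ≡⟨ cong ((B a b + t * e) *_) (matching-bump r u) ⟩
      (B a b + t * e) * (m + t * d)
        ≡⟨ solve 5 (λ x t e m d → (x :+ t :* e) :* (m :+ t :* d) :=
             (x :* m :+ t :* (e :* m :+ x :* d)) :+ t :* t :* (e :* d)) refl _ _ _ _ _ ⟩
      (B a b * m + t * (e * m + B a b * d)) + t * t * (e * d)
        ≡⟨ trans (cong (λ z → (B a b * m + t * (e * m + B a b * d)) + t * t * z) second-order)
             (solve 2 (λ x t → x :+ t :* t :* :0 := x) refl _ _) ⟩
      B a b * m + t * (e * m + B a b * d) ∎
      where
      e = skewUnit k a b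
      m = matching B r
      d = ∂matching k B r
      second-order : e * d ≡ 0#
      second-order with a ℕ.≟ k
      ... | yes refl = trans (cong (e *_) (∂matching-k∉ r (All≢⇒∉ a≢r))) (zeroʳ _)
      ... | no a≢k with b ℕ.≟ k
      ... | yes refl = trans (cong (e *_) (∂matching-k∉ r (All≢⇒∉ b≢r))) (zeroʳ _)
      ... | no b≢k = trans (cong (_* d) (skewUnit-≢k a≢k b≢k)) (zeroˡ _)

    pf-bump-∂ : ∀ {t B l} → Unique l →
      pf (bump k t B) l ≡ pf B l + t * permΣ l (λ σ → sgn σ * ∂matching k B σ)
    pf-bump-∂ {t} {B} {l} u = begin
      pf (bump k t B) l
        ≡⟨ permΣ-cong l (λ σ p → trans
             (cong (sgn σ *_) (matching-bump σ (Unique-resp-↭ (↭-sym p) u)))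
             (solve 4 (λ s x t y → s :* (x :+ t :* y) := s :* x :+ t :* (s :* y)) refl _ _ _ _)) ⟩
      permΣ l (λ σ → sgn σ * matching B σ + t * (sgn σ * ∂matching k B σ))
        ≡⟨ permΣ-+ l _ _ ⟩
      pf B l + permΣ l (λ σ → t * (sgn σ * ∂matching k B σ))
        ≡⟨ cong (pf B l +_) (permΣ-* l t _) ⟩
      pf B l + t * permΣ l (λ σ → sgn σ * ∂matching k B σ) ∎

    pf-bump-∉ : ∀ {t B l} → Unique l → k ∉ l ⊎ suc k ∉ l → pf (bump k t B) l ≡ pf B l
    pf-bump-∉ {t} {B} {l} u ∉l = trans (pf-bump-∂ u) (trans
      (cong (λ z → pf B l + t * z) (trans
        (permΣ-cong l (λ σ p → trans (cong (sgn σ *_) (vanish σ p ∉l)) (trans (zeroʳ _) (sym (zeroˡ (sgn σ))))))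
        (trans (permΣ-* l 0# sgn) (zeroˡ _))))
      (solve 2 (λ x t → x :+ t :* :0 := x) refl _ _))
      where
      vanish : ∀ σ → σ ↭ l → k ∉ l ⊎ suc k ∉ l → ∂matching k B σ ≡ 0#
      vanish σ p (inj₁ k∉)   = ∂matching-k∉ σ (k∉ ∘ ∈-resp-↭ p)
      vanish σ p (inj₂ 1+k∉) = ∂matching-1+k∉ σ (1+k∉ ∘ ∈-resp-↭ p)

    module _ (B : Matrix) where
      term ∂term : List ℕ → Carrier
      term  σ = sgn σ * matching B σ
      ∂term σ = sgn σ * ∂matching k B σ

      ∂term-0 : ∀ a b r → skewUnit k a b ≡ 0# → ∂matching k B r ≡ 0# → ∂term (a ∷ b ∷ r) ≡ 0#
      ∂term-0 a b r e d = trans (cong (sgn (a ∷ b ∷ r) *_) (∂matching-∷∷ {B} {a} {b} {r} e d)) (zeroʳ _)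

      -- `suc k` and `k` each exceed all of `r`, so these inversions contribute the square of a
      -- sign. The one inversion between `suc k` and `k` offsets the minus sign of the skew unit; in
      -- the ascending order neither is present.
      ∂term-desc : ∀ {r} → All (ℕ._< k) r → ∂term (suc k ∷ k ∷ r) ≡ term r
      ∂term-desc {r} r<k
        rewrite <ᵇ-true (ℕₚ.n<1+n k) | smaller-max r (All.map ℕₚ.m<n⇒m<1+n r<k) | smaller-max r r<k
              | ∂matching-k∉ {B} r (All<⇒∉ r<k) | skewUnit-1+k-k
              | neg1^-+ (length r) (length r ℕ.+ inversionCount r) | neg1^-+ (length r) (inversionCount r) = begin
        - (s * (s * sgn r)) * (- 1# * matching B r + B (suc k) k * 0#)
          ≡⟨ solve 5 (λ s g o m x → (:- (s :* (s :* g))) :* ((:- o) :* m :+ x :* :0) := (s :* s) :* (g :* (o :* m))) refl _ _ _ _ _ ⟩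
        (s * s) * (sgn r * (1# * matching B r))
          ≡⟨ trans (cong₂ (λ p q → p * (sgn r * q)) (neg1^-square (length r)) (*-idˡ _)) (*-idˡ _) ⟩
        sgn r * matching B r ∎
        where s = neg1^ (length r)

      ∂term-asc : ∀ {r} → All (ℕ._< k) r → ∂term (k ∷ suc k ∷ r) ≡ term r
      ∂term-asc {r} r<k
        rewrite smaller-> {k} {suc k} r (ℕₚ.n≤1+n k) | smaller-max r (All.map ℕₚ.m<n⇒m<1+n r<k) | smaller-max r r<k
              | ∂matching-k∉ {B} r (All<⇒∉ r<k) | skewUnit-k-1+k
              | neg1^-+ (length r) (length r ℕ.+ inversionCount r) | neg1^-+ (length r) (inversionCount r) = begin
        (s * (s * sgn r)) * (1# * matching B r + B k (suc k) * 0#)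
          ≡⟨ solve 5 (λ s g o m x → (s :* (s :* g)) :* (o :* m :+ x :* :0) := (s :* s) :* (g :* (o :* m))) refl _ _ _ _ _ ⟩
        (s * s) * (sgn r * (1# * matching B r))
          ≡⟨ trans (cong₂ (λ p q → p * (sgn r * q)) (neg1^-square (length r)) (*-idˡ _)) (*-idˡ _) ⟩
        sgn r * matching B r ∎
        where s = neg1^ (length r)

      prefix : ℕ → ℕ → List ℕ → Carrier
      prefix a b r = neg1^ (smaller a (b ∷ r)) * neg1^ (smaller b r) * B a b

      term-∷∷ : ∀ a b r → term (a ∷ b ∷ r) ≡ prefix a b r * term r
      term-∷∷ a b r
        rewrite neg1^-+ (smaller a (b ∷ r)) (smaller b r ℕ.+ inversionCount r) | neg1^-+ (smaller b r) (inversionCount r) =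
        solve 5 (λ p q s x m → (p :* (q :* s)) :* (x :* m) := (p :* q :* x) :* (s :* m)) refl _ _ _ _ _

      -- `k` and `suc k` are larger than `a` and `b`, so inserting them further back adds no
      -- inversion with the leading pair: its factor is already determined by `r`.
      ∂term-∷∷ : ∀ a b {r σ} → a ℕ.< k → b ℕ.< k → σ ↭ suc k ∷ k ∷ r → ∂term (a ∷ b ∷ σ) ≡ prefix a b r * ∂term σ
      ∂term-∷∷ a b {r} {σ} a<k b<k p
        rewrite skewUnit-≢k {a} {b} (ℕₚ.<⇒≢ a<k) (ℕₚ.<⇒≢ b<k)
              | trans (smaller-↭ a p) (trans (smaller-> (k ∷ r) (ℕₚ.m≤n⇒m≤1+n (ℕₚ.<⇒≤ a<k))) (smaller-> r (ℕₚ.<⇒≤ a<k)))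
              | trans (smaller-↭ b p) (trans (smaller-> (k ∷ r) (ℕₚ.m≤n⇒m≤1+n (ℕₚ.<⇒≤ b<k))) (smaller-> r (ℕₚ.<⇒≤ b<k)))
              | neg1^-+ (smaller a (b ∷ r)) (smaller b r ℕ.+ inversionCount σ) | neg1^-+ (smaller b r) (inversionCount σ) =
        solve 6 (λ p q s x m d → (p :* (q :* s)) :* (:0 :* m :+ x :* d) := (p :* q :* x) :* (s :* d)) refl _ _ _ _ _ _

      -- Only the insertions putting k and k + 1 into a common pair survive: one per order and per pair position.
      ∂term-insertions : ∀ {τ} → EvenLength τ → All (ℕ._< k) τ →
        insΣ k τ (λ ρ → insΣ (suc k) ρ ∂term) ≡ fromℕ (length τ ℕ.+ 2) * term τ
      ∂term-insertions [] [] = trans (cong₂ _+_ (∂term-desc []) (∂term-asc []))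
        (trans (cong₂ _+_ (sym (*-idˡ _)) (sym (trans (cong (_* term []) (+-identityʳ 1#)) (*-idˡ _))))
          (sym (distribʳ _ _ _)))
      ∂term-insertions {a ∷ b ∷ r} (∷∷ ev) (a<k ∷ b<k ∷ r<k) = begin
        -- The three groups have `k` in front of `a`, between `a` and `b`, and behind `b`. The two
        -- orders with `k` and `suc k` both in front give `w` each, the case with both behind `b` is
        -- the induction hypothesis for `r`, and every other placement separates `k` from `suc k`.
        (∂term (x ∷ y ∷ a ∷ b ∷ r) + (∂term (y ∷ x ∷ a ∷ b ∷ r) + insΣ x (b ∷ r) (λ σ → ∂term (y ∷ a ∷ σ))))
        + ((∂term (x ∷ a ∷ y ∷ b ∷ r) + (∂term (a ∷ x ∷ y ∷ b ∷ r) + insΣ x (b ∷ r) (λ σ → ∂term (a ∷ y ∷ σ))))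
          + insΣ y r (λ ρ → ∂term (x ∷ a ∷ b ∷ ρ) + (∂term (a ∷ x ∷ b ∷ ρ) + insΣ x ρ (λ σ → ∂term (a ∷ b ∷ σ)))))
          ≡⟨ cong₂ _+_
               (cong₂ _+_ (∂term-desc abr<k) (cong₂ _+_ (∂term-asc abr<k)
                 (insΣ-0 x (b ∷ r) {λ σ → ∂term (y ∷ a ∷ σ)} (λ σ p → ∂term-0 y a σ (skewUnit-≢1+k y≢x a≢x) (∂matching-k∉ σ (k∉ p))))))
               (cong₂ _+_
                 (cong₂ _+_ (∂term-0 x a (y ∷ b ∷ r) (skewUnit-≢k x≢y a≢y) (∂matching-1+k∉ (y ∷ b ∷ r) x∉ybr))
                   (cong₂ _+_ (∂term-0 a x (y ∷ b ∷ r) (skewUnit-≢k a≢y x≢y) (∂matching-1+k∉ (y ∷ b ∷ r) x∉ybr))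
                     (insΣ-0 x (b ∷ r) {λ σ → ∂term (a ∷ y ∷ σ)} (λ σ p → ∂term-0 a y σ (skewUnit-≢1+k a≢x y≢x) (∂matching-k∉ σ (k∉ p))))))
                 (insΣ-cong y r (λ ρ p → trans
                   (cong₂ _+_ (∂term-0 x a (b ∷ ρ) (skewUnit-≢k x≢y a≢y) (∂matching-1+k∉ (b ∷ ρ) (1+k∉ p)))
                     (cong₂ _+_ (∂term-0 a x (b ∷ ρ) (skewUnit-≢k a≢y x≢y) (∂matching-1+k∉ (b ∷ ρ) (1+k∉ p)))
                       (trans (insΣ-cong x ρ (λ σ q → ∂term-∷∷ a b a<k b<k (↭-trans q (↭.prep x p))))
                         (insΣ-* x ρ c ∂term))))
                   (trans (+-idˡ _) (+-idˡ _))))) ⟩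
        (w + (w + 0#)) + ((0# + (0# + 0#)) + insΣ y r (λ ρ → c * insΣ x ρ ∂term))
          ≡⟨ cong (λ z → (w + (w + 0#)) + ((0# + (0# + 0#)) + z))
               (trans (insΣ-* y r c _) (cong (c *_) (∂term-insertions ev r<k))) ⟩
        (w + (w + 0#)) + ((0# + (0# + 0#)) + c * (fromℕ (length r ℕ.+ 2) * term r))
          ≡⟨ solve 4 (λ w c n v → (w :+ (w :+ :0)) :+ ((:0 :+ (:0 :+ :0)) :+ c :* (n :* v)) := w :+ (w :+ n :* (c :* v))) refl _ _ _ _ ⟩
        w + (w + fromℕ (length r ℕ.+ 2) * (c * term r))
          ≡⟨ cong (λ z → w + (w + fromℕ (length r ℕ.+ 2) * z)) (sym (term-∷∷ a b r)) ⟩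
        w + (w + fromℕ (length r ℕ.+ 2) * w)
          ≡⟨ one-more (suc (length r ℕ.+ 2)) (one-more (length r ℕ.+ 2) refl) ⟩
        fromℕ (length (a ∷ b ∷ r) ℕ.+ 2) * w ∎
        where
        x = suc k
        y = k
        w = term (a ∷ b ∷ r)
        c = prefix a b r
        abr<k = a<k ∷ b<k ∷ r<k
        x≢y : x ≢ y
        x≢y = ℕₚ.1+n≢n
        y≢x : y ≢ x
        y≢x = x≢y ∘ sym
        a≢y = ℕₚ.<⇒≢ a<k
        a≢x = ℕₚ.<⇒≢ (ℕₚ.m<n⇒m<1+n a<k)
        k∉ : ∀ {σ} → σ ↭ x ∷ b ∷ r → y ∉ σ
        k∉ p = All<⇒∉ (b<k ∷ r<k) ∘ tail-∈ y≢x ∘ ∈-resp-↭ p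
        x∉br : x ∉ b ∷ r
        x∉br = All<⇒∉ (All.map ℕₚ.m<n⇒m<1+n (b<k ∷ r<k))
        x∉ybr : x ∉ y ∷ b ∷ r
        x∉ybr = x∉br ∘ tail-∈ x≢y
        1+k∉ : ∀ {ρ} → ρ ↭ y ∷ r → x ∉ b ∷ ρ
        1+k∉ p (here refl) = x∉br (here refl)
        1+k∉ p (there x∈)  = x∉br (there (tail-∈ x≢y (∈-resp-↭ p x∈)))
        one-more : ∀ {z} n → z ≡ fromℕ n * w → w + z ≡ fromℕ (suc n) * w
        one-more n eq = trans (cong₂ _+_ (sym (*-idˡ w)) eq) (sym (distribʳ _ _ _))

      -- The factor `length l + 2` equals 2(m+1), the quotient of the normalising factors 2^{m+1}
      -- (m+1)! and 2^m m! that `pf` leaves out.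
      pf-bump : ∀ {t m l} → length l ≡ m ℕ.* 2 → Unique (suc k ∷ k ∷ l) → All (ℕ._< k) l →
        pf (bump k t B) (suc k ∷ k ∷ l) ≡ pf B (suc k ∷ k ∷ l) + t * (fromℕ (length l ℕ.+ 2) * pf B l)
      pf-bump {t} {m} {l} ∣l∣ u l<k = trans (pf-bump-∂ u) (cong (λ z → pf B (suc k ∷ k ∷ l) + t * z) (trans
        (permΣ-cong l (λ τ p → trans
          (∂term-insertions (evenLength m τ (trans (↭-length p) ∣l∣)) (All-resp-↭ (↭-sym p) l<k))
          (cong (λ n → fromℕ (n ℕ.+ 2) * term τ) (↭-length p))))
        (permΣ-* l (fromℕ (length l ℕ.+ 2)) term)))

-- Positivity along the word

-- Each block places the two largest elements of an index set; listing from the largest down puts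
-- them at the head and leaves the smaller set as the tail.
Descending : List ℕ → Set
Descending = AllPairs ℕ._>_

-- Used twice: it bounds the two largest indices from below, so that the truncated runs of a block
-- reach them, and it bounds the size of a set by the number of blocks.
descending⇒length≤ : ∀ {q l} → Descending l → All (ℕ._< q) l → length l ℕ.≤ q
descending⇒length≤ []         []        = ℕ.z≤n
descending⇒length≤ (x>l ∷ d) (x<q ∷ _) = ℕₚ.≤-trans (ℕ.s≤s (descending⇒length≤ d x>l)) x<q

record Admissible (n : ℕ) (l : List ℕ) : Set where
  constructor admissible
  field
    half      : ℕ
    length≡   : length l ≡ half ℕ.* 2
    unique    : Unique l
    bounded   : All (ℕ._< n) l
open Admissible

admissible-↭ : ∀ {n l l′} → l ↭ l′ → Admissible n l → Admissible n l′
admissible-↭ p (admissible m ∣l∣ u b) =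
  admissible m (trans (sym (↭-length p)) ∣l∣) (Unique-resp-↭ p u) (All-resp-↭ p b)

admissible-replace : ∀ {n x y l} → y ℕ.< n → y ∉ l → Admissible n (x ∷ l) → Admissible n (y ∷ l)
admissible-replace y<n y∉ (admissible m ∣l∣ (_ ∷ u) (_ ∷ b)) =
  admissible m ∣l∣ (All.map (λ z≢y y≡z → z≢y (sym y≡z)) (∉⇒All≢ y∉) ∷ u) (y<n ∷ b)

descending-admissible : ∀ {n l} m → length l ≡ m ℕ.* 2 → Descending l → All (ℕ._< n) l → Admissible n l
descending-admissible m ∣l∣ d b = admissible m ∣l∣ (distinct d) b
  where
  distinct : ∀ {l} → Descending l → Unique l
  distinct []        = []
  distinct (x> ∷ d) = All.map (λ x>y x≡y → ℕₚ.<-irrefl (sym x≡y) x>y) x> ∷ distinct d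

module Positivity (ℝ : RealField) where
  open RealField ℝ hiding (_-_)
  open Reals ℝ
  open OrderedField ℝ
  open Pfaffian ℝ
  open Bump ℝ

  -- Letters are 1-based and matrix indices 0-based: letter `suc i` changes row and column `i`, and
  -- letter `n` acts on the indices n - 2 and n - 1.
  data Step (n : ℕ) : ℕ → Matrix → Matrix → Set where
    shearing : ∀ {i t B} → suc i ℕ.< n → 0# < t → Step n (suc i) B (shear i t B)
    bumping  : ∀ {k t B} → n ≡ suc (suc k) → 0# < t → Step n n B (bump k t B)

  data Run (n : ℕ) : List ℕ → Matrix → Matrix → Set where
    []  : ∀ {B} → Run n [] B B
    _∷_ : ∀ {i w B B′ B″} → Step n i B B′ → Run n w B′ B″ → Run n (i ∷ w) B B″

  run-++ : ∀ {n} w {w′ B B″} → Run n (w ++ w′) B B″ → ∃ λ B′ → Run n w B B′ × Run n w′ B′ B″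
  run-++ []      r       = _ , [] , r
  run-++ (i ∷ w) (s ∷ r) with run-++ w r
  ... | B′ , r₁ , r₂ = B′ , s ∷ r₁ , r₂

  PfNonneg : ℕ → Matrix → Set
  PfNonneg n B = ∀ l → Admissible n l → Nonneg (pf B l)

  PfPos : Matrix → List ℕ → Set
  PfPos B l = 0# < pf B l

  pfPos-↭ : ∀ B {l l′} → l ↭ l′ → PfPos B l → PfPos B l′
  pfPos-↭ B p = subst (0# <_) (pf-↭ B p)

  pfPos-swap : ∀ B x y l → PfPos B (x ∷ y ∷ l) → PfPos B (y ∷ x ∷ l)
  pfPos-swap B x y l = pfPos-↭ B (↭.swap x y (↭.refl {xs = l}))

  pf-shear-∷ : ∀ {n i l} {t} B → Admissible n (i ∷ l) → suc i ∉ l →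
    pf (shear i t B) (i ∷ l) ≡ pf B (i ∷ l) + t * pf B (suc i ∷ l)
  pf-shear-∷ {i = i} {l} {t} B (admissible m ∣l∣ u@(i≢l ∷ _) _) 1+i∉ = trans
    (pf-shear-move {m} ∣l∣ u {i} {t} {B} (here refl) (1+i∉ ∘ tail-∈ ℕₚ.1+n≢n))
    (cong (λ l′ → pf B (i ∷ l) + t * pf B l′)
      (cong₂ _∷_ (transposition-i i) (transposition-map-fix l (All≢⇒∉ i≢l) 1+i∉)))

  -- The increment is zero or a positive multiple of the Pfaffian of `B` on another admissible list.
  -- That is why nonnegativity must be assumed for all lists at once.
  step-increases : ∀ {n i B B′} → PfNonneg n B → Step n i B B′ → ∀ l → Admissible n l →
    ∃ λ d → Nonneg d × pf B′ l ≡ pf B l + d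
  step-increases {B = B} nonneg (shearing {i} {t} 1+i<n 0<t) l adm@(admissible m ∣l∣ u _) with i ∈? l | suc i ∈? l
  ... | no i∉  | _        = 0# , inj₂ refl , trans (pf-shear-∉ {m} ∣l∣ u i∉) (sym (+-identityʳ _))
  ... | yes i∈ | yes 1+i∈ = 0# , inj₂ refl , trans (pf-shear-both {m} ∣l∣ u i∈ 1+i∈) (sym (+-identityʳ _))
  ... | yes i∈ | no 1+i∉ with ∈⇒↭ i∈
  ... | l′ , p = t * pf B (suc i ∷ l′)
      , *-pos-nonneg 0<t (nonneg _ (admissible-replace 1+i<n 1+i∉l′ adm′))
      , trans (pf-↭ (shear i t B) p) (trans (pf-shear-∷ B adm′ 1+i∉l′)
          (cong (_+ t * pf B (suc i ∷ l′)) (pf-↭ B (↭-sym p))))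
    where
    adm′ = admissible-↭ p adm
    1+i∉l′ : suc i ∉ l′
    1+i∉l′ = 1+i∉ ∘ ∈-resp-↭ (↭-sym p) ∘ there
  step-increases {B = B} nonneg (bumping {k} {t} refl 0<t) l adm with k ∈? l | suc k ∈? l
  ... | no k∉  | _       = 0# , inj₂ refl , trans (pf-bump-∉ (unique adm) (inj₁ k∉)) (sym (+-identityʳ _))
  ... | yes _  | no 1+k∉ = 0# , inj₂ refl , trans (pf-bump-∉ (unique adm) (inj₂ 1+k∉)) (sym (+-identityʳ _))
  ... | yes k∈ | yes 1+k∈ with ∈⇒↭ 1+k∈
  ... | l₁ , p₁ with ∈⇒↭ (tail-∈ (ℕₚ.1+n≢n ∘ sym) (∈-resp-↭ p₁ k∈))
  ... | l₂ , p₂ with ↭-trans p₁ (↭.prep (suc k) p₂)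
  ... | p with admissible-↭ p adm
  ... | admissible (suc m) ∣l∣ u@((_ ∷ 1+k≢) ∷ (k≢ ∷ u₂)) (_ ∷ _ ∷ b) =
        t * (fromℕ (length l₂ ℕ.+ 2) * pf B l₂)
      , *-pos-nonneg 0<t (*-pos-nonneg (subst (0# <_) (cong fromℕ (ℕₚ.+-comm 2 (length l₂))) (fromℕ-pos (suc (length l₂))))
          (nonneg l₂ (admissible m ∣l₂∣ u₂ b)))
      , trans (pf-↭ (bump k t B) p) (trans (pf-bump B {t} {m} {l₂} ∣l₂∣ u below)
          (cong (_+ t * (fromℕ (length l₂ ℕ.+ 2) * pf B l₂)) (pf-↭ B (↭-sym p))))
    where
    ∣l₂∣ = ℕₚ.suc-injective (ℕₚ.suc-injective ∣l∣)
    below : All (ℕ._< k) l₂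
    below = All.zipWith (λ (x<2+k , k≢x , 1+k≢x) →
      ℕₚ.≤∧≢⇒< (ℕ.s≤s⁻¹ (ℕₚ.≤∧≢⇒< (ℕ.s≤s⁻¹ x<2+k) (1+k≢x ∘ sym))) (k≢x ∘ sym)) (b , All.zip (k≢ , 1+k≢))

  step-nonneg : ∀ {n i B B′} → Step n i B B′ → PfNonneg n B → PfNonneg n B′
  step-nonneg s nonneg l adm with step-increases nonneg s l adm
  ... | d , 0≤d , eq = subst Nonneg (sym eq) (+-nonneg (nonneg l adm) 0≤d)

  step-pos : ∀ {n i B B′ l} → Step n i B B′ → PfNonneg n B → Admissible n l → PfPos B l → PfPos B′ l
  step-pos {l = l} s nonneg adm 0<pf with step-increases nonneg s l adm
  ... | d , 0≤d , eq = subst (0# <_) (sym eq) (+-pos-nonneg 0<pf 0≤d)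

  run-nonneg : ∀ {n w B B′} → Run n w B B′ → PfNonneg n B → PfNonneg n B′
  run-nonneg []      nonneg = nonneg
  run-nonneg (s ∷ r) nonneg = run-nonneg r (step-nonneg s nonneg)

  run-pos : ∀ {n w B B′ l} → Run n w B B′ → PfNonneg n B → Admissible n l → PfPos B l → PfPos B′ l
  run-pos []      nonneg adm 0<pf = 0<pf
  run-pos (s ∷ r) nonneg adm 0<pf = run-pos r (step-nonneg s nonneg) adm (step-pos s nonneg adm 0<pf)

  -- The Pfaffian at `i ∷ l` gains `t` times the one at `suc i ∷ l`, so positivity passes from the
  -- higher index to the lower one.
  step-moves : ∀ {n i B B′ l} → suc i ℕ.< n → Step n (suc i) B B′ → PfNonneg n B →
    i ∉ l → Admissible n (suc i ∷ l) → PfPos B (suc i ∷ l) → PfPos B′ (i ∷ l)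
  step-moves {i = i} {B} {l = l} 1+i<n (shearing {t = t} _ 0<t) nonneg i∉ adm@(admissible _ _ (1+i≢ ∷ _) _) 0<pf =
    subst (0# <_) (sym (pf-shear-∷ B adm′ (All≢⇒∉ 1+i≢)))
      (+-nonneg-pos (nonneg _ adm′) (*-pos 0<t 0<pf))
    where adm′ = admissible-replace (ℕₚ.<-trans (ℕₚ.n<1+n i) 1+i<n) i∉ adm
  step-moves 1+i<n (bumping _ _) nonneg i∉ adm 0<pf = contradiction 1+i<n (ℕₚ.<-irrefl refl)

  step-creates : ∀ {k B B′ l} → Step (suc (suc k)) (suc (suc k)) B B′ → PfNonneg (suc (suc k)) B →
    All (ℕ._< k) l → Admissible (suc (suc k)) (suc k ∷ k ∷ l) → PfPos B l → PfPos B′ (suc k ∷ k ∷ l)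
  step-creates (shearing 1+i<n _) nonneg l<k adm 0<pf = contradiction 1+i<n (ℕₚ.<-irrefl refl)
  step-creates {k} {B} {l = l} (bumping {t = t} refl 0<t) nonneg l<k adm@(admissible (suc m) ∣l∣ u _) 0<pf =
    subst (0# <_) (sym (pf-bump B {t} {m} {l} (ℕₚ.suc-injective (ℕₚ.suc-injective ∣l∣)) u l<k))
      (+-nonneg-pos (nonneg _ adm) (*-pos 0<t (*-pos
        (subst (0# <_) (cong fromℕ (ℕₚ.+-comm 2 (length l))) (fromℕ-pos (suc (length l)))) 0<pf)))

  -- The run `desc a (suc b)` can carry an index from `a` as far as `b`, one place per letter. Once
  -- the target `z` is reached, the remaining letters need only preserve positivity. The hypothesis
  -- on `l` keeps the path from `a` down to `z` free of other indices.
  desc-moves : ∀ {n b z B B′ l} a → Run n (desc a (suc b)) B B′ → a ℕ.< n → PfNonneg n B →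
    b ℕ.≤ z → z ℕ.≤ a → All (λ x → x ℕ.< z ⊎ a ℕ.< x) l →
    Admissible n (a ∷ l) → PfPos B (a ∷ l) → PfPos B′ (z ∷ l)
  desc-moves zero [] a<n nonneg b≤z ℕ.z≤n gap adm 0<pf = 0<pf
  desc-moves {b = b} {z} {B} {l = l} (suc a) r a<n nonneg b≤z z≤a gap adm 0<pf with b <ᵇ suc a in eq
  desc-moves {b = b} {z} {B} {l = l} (suc a) [] a<n nonneg b≤z z≤a gap adm 0<pf | false =
    subst (λ x → PfPos B (x ∷ l)) (ℕₚ.≤-antisym (ℕₚ.≤-trans (ℕₚ.≮⇒≥ (λ b<1+a → true≢false (trans (sym (<ᵇ-true b<1+a)) eq))) b≤z) z≤a) 0<pf
    where
    true≢false : true ≢ false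
    true≢false ()
  desc-moves {n} {b} {z} {B} {l = l} (suc a) (s ∷ r) a<n nonneg b≤z z≤a gap adm 0<pf | true with ℕₚ.m≤n⇒m<n∨m≡n z≤a
  ... | inj₂ refl = run-pos r (step-nonneg s nonneg) adm (step-pos s nonneg adm 0<pf)
  ... | inj₁ z<1+a = desc-moves a r (ℕₚ.<-trans (ℕₚ.n<1+n a) a<n) (step-nonneg s nonneg) b≤z (ℕ.s≤s⁻¹ z<1+a)
      (All.map (map₂ (ℕₚ.<-trans (ℕₚ.n<1+n a))) gap)
      (admissible-replace (ℕₚ.<-trans (ℕₚ.n<1+n a) a<n) a∉ adm)
      (step-moves a<n s nonneg a∉ adm 0<pf)
    where
    a∉ : a ∉ l
    a∉ a∈ with All.lookup gap a∈
    ... | inj₁ a<z = ℕₚ.<⇒≱ a<z (ℕ.s≤s⁻¹ z<1+a)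
    ... | inj₂ 1+a<a = ℕₚ.<⇒≱ 1+a<a (ℕₚ.n≤1+n a)

  -- Induction over the blocks

  DescendingPos : ℕ → ℕ → Matrix → Set
  DescendingPos n m B = ∀ l → length l ≡ m ℕ.* 2 → Descending l → All (ℕ._< n) l → PfPos B l

  -- The tail `l` has size 2j and is positive before the block. The first letter adjoins `suc k` and
  -- `k`; then `k` descends to `q`, clearing the way for `suc k` to descend to `p`. The bounds
  -- `2j≤q` and `1+2j≤p` place both targets within the truncated runs.
  block-pos : ∀ {k} j {B B′} → let n = suc (suc k) in
    Run n (block n (suc j)) B B′ → PfNonneg n B → DescendingPos n j B → DescendingPos n (suc j) B′
  block-pos {k} j {B} {B′} (_∷_ {B′ = B₀} s r) nonneg pos (p ∷ q ∷ l) ∣pql∣ ((p>q ∷ p>l) ∷ (q>l ∷ d)) (p<n ∷ q<n ∷ l<n)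
    with run-++ (desc k (2 ℕ.* suc j ∸ 1)) r
  ... | B₁ , r₁ , r₂ =
    desc-moves (suc k) (subst (λ b → Run n (desc (suc k) b) B₁ B′) 2m≡ r₂) (ℕₚ.n<1+n (suc k))
      (run-nonneg r₁ (step-nonneg s nonneg)) 1+2j≤p (ℕ.s≤s⁻¹ p<n)
      (inj₁ p>q ∷ All.map inj₁ p>l)
      (admissible-↭ (↭.swap q (suc k) ↭.refl) adm₂)
      (pfPos-swap B₁ q (suc k) l pos₂)
    where
    n = suc (suc k)
    ∣l∣ : length l ≡ j ℕ.* 2
    ∣l∣ = ℕₚ.suc-injective (ℕₚ.suc-injective ∣pql∣)
    2m≡ : 2 ℕ.* suc j ≡ suc (suc (j ℕ.* 2))
    2m≡ = ℕₚ.*-comm 2 (suc j)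
    q≤k : q ℕ.≤ k
    q≤k = ℕ.s≤s⁻¹ (ℕₚ.<-≤-trans p>q (ℕ.s≤s⁻¹ p<n))
    l<k : All (ℕ._< k) l
    l<k = All.map (λ x<q → ℕₚ.<-≤-trans x<q q≤k) q>l
    2j≤q : j ℕ.* 2 ℕ.≤ q
    2j≤q = subst (ℕ._≤ q) ∣l∣ (descending⇒length≤ d q>l)
    1+2j≤p : suc (j ℕ.* 2) ℕ.≤ p
    1+2j≤p = ℕₚ.≤-<-trans 2j≤q p>q
    adm₀ : Admissible n (suc k ∷ k ∷ l)
    adm₀ = descending-admissible (suc j) (cong (suc ∘ suc) ∣l∣)
      ((ℕₚ.n<1+n k ∷ All.map ℕₚ.m<n⇒m<1+n l<k) ∷ l<k ∷ d)
      (ℕₚ.n<1+n _ ∷ ℕₚ.m<n⇒m<1+n (ℕₚ.n<1+n _) ∷ l<n)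
    adm₁ : Admissible n (k ∷ suc k ∷ l)
    adm₁ = admissible-↭ (↭.swap (suc k) k ↭.refl) adm₀
    adm₂ : Admissible n (q ∷ suc k ∷ l)
    adm₂ = admissible-replace q<n q∉ adm₁
      where
      q∉ : q ∉ suc k ∷ l
      q∉ (here refl) = ℕₚ.<⇒≱ (ℕₚ.n<1+n k) q≤k
      q∉ (there q∈)  = All<⇒∉ q>l q∈
    pos₂ : PfPos B₁ (q ∷ suc k ∷ l)
    pos₂ = desc-moves k (subst (λ b → Run n (desc k b) B₀ B₁) (cong (_∸ 1) 2m≡) r₁) (ℕₚ.m<n⇒m<1+n (ℕₚ.n<1+n k))
      (step-nonneg s nonneg) 2j≤q q≤k (inj₂ (ℕₚ.n<1+n k) ∷ All.map inj₁ q>l) adm₁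
      (pfPos-swap B₀ (suc k) k l (step-creates s nonneg l<k adm₀ (pos l ∣l∣ d l<n)))

  -- `applyUpTo` recurses by composing its function with `suc`, hence the general `f`. Sizes reached
  -- by earlier blocks stay positive because Pfaffians never decrease, and the newest size comes
  -- from `block-pos`.
  blocks-pos : ∀ {k} j h (f : ℕ → ℕ) → (∀ i → f i ≡ suc (j ℕ.+ i)) → ∀ {B B′} → let n = suc (suc k) in
    Run n (concatMap (block n) (applyUpTo f h)) B B′ → PfNonneg n B →
    (∀ m → m ℕ.≤ j → DescendingPos n m B) → ∀ m → m ℕ.≤ j ℕ.+ h → DescendingPos n m B′
  blocks-pos j zero    f f≗ [] nonneg pos m m≤ = pos m (subst (m ℕ.≤_) (ℕₚ.+-identityʳ j) m≤)
  blocks-pos {k} j (suc h) f f≗ {B} r nonneg pos m m≤ with run-++ (block (suc (suc k)) (f 0)) r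
  ... | B₁ , r₁ , r₂ = blocks-pos (suc j) h (f ∘ suc) (λ i → trans (f≗ (suc i)) (cong suc (ℕₚ.+-suc j i))) r₂
    (run-nonneg r₁ nonneg) pos₁ m (subst (m ℕ.≤_) (ℕₚ.+-suc j h) m≤)
    where
    pos₁ : ∀ m → m ℕ.≤ suc j → DescendingPos (suc (suc k)) m B₁
    pos₁ m m≤1+j with ℕₚ.m≤n⇒m<n∨m≡n m≤1+j
    ... | inj₁ m<1+j = λ l ∣l∣ d b → run-pos r₁ nonneg (descending-admissible m ∣l∣ d b)
                         (pos m (ℕ.s≤s⁻¹ m<1+j) l ∣l∣ d b)
    ... | inj₂ refl = block-pos j
          (subst (λ i → Run (suc (suc k)) (block (suc (suc k)) i) B B₁) (trans (f≗ 0) (cong suc (ℕₚ.+-identityʳ j))) r₁)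
          nonneg (pos j ℕₚ.≤-refl)

  zeroMatrix : Matrix
  zeroMatrix _ _ = 0#

  pf-zeroMatrix-[] : PfPos zeroMatrix []
  pf-zeroMatrix-[] = subst (0# <_) (sym (*-idˡ 1#)) 0<1

  pf-zeroMatrix : ∀ n → PfNonneg n zeroMatrix
  pf-zeroMatrix n []      adm = inj₁ pf-zeroMatrix-[]
  pf-zeroMatrix n (x ∷ l) (admissible (suc m) ∣l∣ _ _) = inj₂ (trans
    (permΣ-cong (x ∷ l) (λ σ p → trans (cong (sgn σ *_) (vanish σ (evenLength (suc m) σ (trans (↭-length p) ∣l∣)) (↭-length p)))
      (trans (zeroʳ _) (sym (zeroˡ (sgn σ))))))
    (trans (permΣ-* (x ∷ l) 0# sgn) (zeroˡ _)))
    where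
    vanish : ∀ σ → EvenLength σ → length σ ≡ suc (length l) → matching zeroMatrix σ ≡ 0#
    vanish (a ∷ b ∷ r) _ _ = zeroˡ _

  word-pos : ∀ n {B} → Run n (word n) zeroMatrix B → ∀ {m l} → length l ≡ m ℕ.* 2 → Descending l → All (ℕ._< n) l → PfPos B l
  word-pos n r {zero} {[]} ∣l∣ d b = run-pos r (pf-zeroMatrix n) (admissible 0 refl [] []) pf-zeroMatrix-[]
  word-pos zero r {suc m} {_ ∷ _} ∣l∣ d (() ∷ _)
  word-pos (suc zero) r {suc m} {_ ∷ _ ∷ _} ∣l∣ ((p>q ∷ _) ∷ _) (p<1 ∷ _) = contradiction (ℕₚ.<-≤-trans p>q (ℕ.s≤s⁻¹ p<1)) λ()
  word-pos n@(suc (suc k)) r {suc m} {l} ∣l∣ d b = blocks-pos 0 ⌊ n /2⌋ suc (λ _ → refl) r (pf-zeroMatrix n)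
    (λ { zero _ [] _ _ _ → pf-zeroMatrix-[] }) (suc m)
    -- A set of 2m indices below `n` forces m ≤ ⌊n/2⌋, which is the number of blocks in the word.
    (subst (ℕ._≤ ⌊ n /2⌋) (trans (cong ⌊_/2⌋ (trans (ℕₚ.*-comm (suc m) 2) (cong (suc m ℕ.+_) (ℕₚ.+-identityʳ (suc m)))))
        (sym (ℕₚ.n≡⌊n+n/2⌋ (suc m))))
      (ℕₚ.⌊n/2⌋-mono (subst (ℕ._≤ n) ∣l∣ (descending⇒length≤ d b)))) l ∣l∣ d b

-- Reduction of the matrix product

≡ᵇ-+ˡ : ∀ n a b → (n ℕ.+ a ≡ᵇ n ℕ.+ b) ≡ (a ≡ᵇ b)
≡ᵇ-+ˡ zero    a b = refl
≡ᵇ-+ˡ (suc n) a b = ≡ᵇ-+ˡ n a b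

≡ᵇ-sym : ∀ a b → (a ≡ᵇ b) ≡ (b ≡ᵇ a)
≡ᵇ-sym zero    zero    = refl
≡ᵇ-sym zero    (suc b) = refl
≡ᵇ-sym (suc a) zero    = refl
≡ᵇ-sym (suc a) (suc b) = ≡ᵇ-sym a b

-- The letters for which `xgen` is one of the two moves. `xgen` chooses by a boolean test, and this
-- view records the bounds that settle the test.
data Letter (n : ℕ) : ℕ → Set where
  shearing : ∀ {i} → suc i ℕ.< n → Letter n (suc i)
  bumping  : ∀ {k} → n ≡ suc (suc k) → Letter n n

module Reduction (ℝ : RealField) where
  open RealField ℝ hiding (_-_)
  open Reals ℝ
  open OrderedField ℝ
  open Pfaffian ℝ
  open Bump ℝ
  open Positivity ℝ using (Step; shearing; bumping; Run; []; _∷_; zeroMatrix)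
  open ≡-Reasoning

  desc-letters : ∀ {n} a b → a ℕ.< n → All (Letter n) (desc a (suc b))
  desc-letters zero    b a<n = []
  desc-letters (suc a) b a<n with b <ᵇ suc a
  ... | true  = shearing a<n ∷ desc-letters a b (ℕₚ.<-trans (ℕₚ.n<1+n a) a<n)
  ... | false = []

  blocks-letters : ∀ k h (f : ℕ → ℕ) → All (Letter (suc (suc k))) (concatMap (block (suc (suc k))) (applyUpTo (λ i → suc (f i)) h))
  blocks-letters k zero    f = []
  blocks-letters k (suc h) f = bumping refl ∷ Allₚ.++⁺
    -- `2 * suc (f 0) ∸ 1` reduces to `f 0 + suc (f 0 + 0)`; the `suc` must come to the front to
    -- match `desc-letters`.
    (Allₚ.++⁺ (subst (λ b → All (Letter (suc (suc k))) (desc k b)) (sym (ℕₚ.+-suc (f 0) (f 0 ℕ.+ 0)))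
           (desc-letters k _ (ℕₚ.m<n⇒m<1+n (ℕₚ.n<1+n k))))
         (desc-letters (suc k) _ (ℕₚ.n<1+n _)))
    (blocks-letters k h (f ∘ suc))

  word-letters : ∀ n → All (Letter n) (word n)
  word-letters zero          = []
  word-letters (suc zero)    = []
  word-letters (suc (suc k)) = blocks-letters k ⌊ suc (suc k) /2⌋ (λ i → i)

  sumFin-cong : ∀ {n} {f g : Fin n → Carrier} → (∀ i → f i ≡ g i) → sumFin f ≡ sumFin g
  sumFin-cong {zero}  eq = refl
  sumFin-cong {suc n} eq = cong₂ _+_ (eq Fin.zero) (sumFin-cong (eq ∘ Fin.suc))

  sumFin-+ : ∀ {n} (f g : Fin n → Carrier) → sumFin (λ i → f i + g i) ≡ sumFin f + sumFin g
  sumFin-+ {zero}  f g = sym (+-idˡ _)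
  sumFin-+ {suc n} f g = trans (cong (f Fin.zero + g Fin.zero +_) (sumFin-+ (f ∘ Fin.suc) (g ∘ Fin.suc)))
    (solve 4 (λ a b c d → (a :+ b) :+ (c :+ d) := (a :+ c) :+ (b :+ d)) refl _ _ _ _)

  sumFin-*ˡ : ∀ {n} c (f : Fin n → Carrier) → sumFin (λ i → c * f i) ≡ c * sumFin f
  sumFin-*ˡ {zero}  c f = sym (zeroʳ c)
  sumFin-*ˡ {suc n} c f = trans (cong (c * f Fin.zero +_) (sumFin-*ˡ c (f ∘ Fin.suc))) (sym (distribˡ _ _ _))

  sumFin-*ʳ : ∀ {n} c (f : Fin n → Carrier) → sumFin (λ i → f i * c) ≡ sumFin f * c
  sumFin-*ʳ c f = trans (sumFin-cong (λ i → *-comm (f i) c)) (trans (sumFin-*ˡ c f) (*-comm _ _))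

  sumFin-0 : ∀ n → sumFin {n} (λ _ → 0#) ≡ 0#
  sumFin-0 zero    = refl
  sumFin-0 (suc n) = trans (+-idˡ _) (sumFin-0 n)

  sumFin-swap : ∀ {m n} (f : Fin m → Fin n → Carrier) →
    sumFin (λ i → sumFin (λ j → f i j)) ≡ sumFin (λ j → sumFin (λ i → f i j))
  sumFin-swap {zero}  {n} f = sym (sumFin-0 n)
  sumFin-swap {suc m} f = trans (cong (sumFin (f Fin.zero) +_) (sumFin-swap (f ∘ Fin.suc)))
    (sym (sumFin-+ (f Fin.zero) (λ j → sumFin (λ i → f (Fin.suc i) j))))

  sumFin-split : ∀ m {n} (f : Fin (m ℕ.+ n) → Carrier) →
    sumFin f ≡ sumFin (λ i → f (i ↑ˡ n)) + sumFin (λ j → f (m ↑ʳ j))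
  sumFin-split zero    f = sym (+-idˡ _)
  sumFin-split (suc m) f = trans (cong (f Fin.zero +_) (sumFin-split m (f ∘ Fin.suc))) (sym (+-assoc _ _ _))

  -- Reading a vector at a natural number allows both halves of a vector of length 2n to be
  -- addressed by arithmetic, as `a` and `n + b`.
  extend : ∀ {m} → (Fin m → Carrier) → ℕ → Carrier
  extend {zero}  v k       = 0#
  extend {suc m} v zero    = v Fin.zero
  extend {suc m} v (suc k) = extend (v ∘ Fin.suc) k

  extend-toℕ : ∀ {m} (v : Fin m → Carrier) i → extend v (toℕ i) ≡ v i
  extend-toℕ v Fin.zero    = refl
  extend-toℕ v (Fin.suc i) = extend-toℕ (v ∘ Fin.suc) i

  extend-∘toℕ : ∀ {n} (g : ℕ → Carrier) {j} → j ℕ.< n → extend {n} (g ∘ toℕ) j ≡ g j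
  extend-∘toℕ {n} g {j} j<n = begin
    extend {n} (g ∘ toℕ) j                    ≡⟨ cong (extend {n} (g ∘ toℕ)) (sym (Finₚ.toℕ-fromℕ< j<n)) ⟩
    extend {n} (g ∘ toℕ) (toℕ (fromℕ< j<n))   ≡⟨ extend-toℕ {n} (g ∘ toℕ) (fromℕ< j<n) ⟩
    g (toℕ (fromℕ< j<n))                  ≡⟨ cong g (Finₚ.toℕ-fromℕ< j<n) ⟩
    g j                                   ∎

  sumFin-δ : ∀ {n} k (v : Fin n → Carrier) → sumFin (λ b → δ (toℕ b) k * v b) ≡ extend v k
  sumFin-δ {zero}  k       v = refl
  sumFin-δ {suc n} zero    v = trans (cong₂ _+_ (*-idˡ _) (trans (sumFin-cong (λ i → zeroˡ (v (Fin.suc i)))) (sumFin-0 n)))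
    (+-identityʳ _)
  sumFin-δ {suc n} (suc k) v = trans (cong₂ _+_ (zeroˡ _) (sumFin-δ k (v ∘ Fin.suc))) (+-idˡ _)

  -- Action of the generators on vectors

  apply : ∀ {m n} → Mat m n → (Fin n → Carrier) → Fin m → Carrier
  apply X v a = sumFin (λ b → X a b * v b)

  apply-⊗ : ∀ {l m n} (X : Mat l m) (Y : Mat m n) v a → apply (X ⊗ Y) v a ≡ apply X (apply Y v) a
  apply-⊗ X Y v a = begin
    sumFin (λ b → sumFin (λ j → X a j * Y j b) * v b)
      ≡⟨ sumFin-cong (λ b → sym (sumFin-*ʳ (v b) (λ j → X a j * Y j b))) ⟩
    sumFin (λ b → sumFin (λ j → X a j * Y j b * v b))
      ≡⟨ sumFin-swap (λ b j → X a j * Y j b * v b) ⟩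
    sumFin (λ j → sumFin (λ b → X a j * Y j b * v b))
      ≡⟨ sumFin-cong (λ j → trans (sumFin-cong (λ b → *-assoc (X a j) (Y j b) (v b))) (sumFin-*ˡ (X a j) (λ b → Y j b * v b))) ⟩
    apply X (apply Y v) a ∎

  apply-Id : ∀ {m} (v : Fin m → Carrier) a → apply Id v a ≡ v a
  apply-Id v a = trans (sumFin-cong (λ b → cong (λ z → ind z * v b) (≡ᵇ-sym (toℕ a) (toℕ b))))
    (trans (sumFin-δ (toℕ a) v) (extend-toℕ v a))

  apply-at : ∀ {m} (v : Fin m → Carrier) a α β →
    sumFin (λ b → at a b (suc α) (suc β) * v b) ≡ δ (toℕ a) α * extend v β
  apply-at {m} v a α β = begin
    sumFin (λ b → ind ((toℕ a ≡ᵇ α) ∧ (toℕ b ≡ᵇ β)) * v b)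
      ≡⟨ sumFin-cong (λ b → trans (cong (_* v b) (ind-∧ (toℕ a ≡ᵇ α) (toℕ b ≡ᵇ β))) (*-assoc _ _ _)) ⟩
    sumFin (λ b → δ (toℕ a) α * (δ (toℕ b) β * v b))
      ≡⟨ trans (sumFin-*ˡ {m} (δ (toℕ a) α) _) (cong (δ (toℕ a) α *_) (sumFin-δ β v)) ⟩
    δ (toℕ a) α * extend v β ∎
    where
    ind-∧ : ∀ x y → ind (x ∧ y) ≡ ind x * ind y
    ind-∧ true  y = sym (*-idˡ _)
    ind-∧ false y = sym (zeroˡ _)

  apply-elementary : ∀ {m} (v : Fin m → Carrier) t a α β γ ε →
    sumFin (λ b → (Id a b + t * at a b (suc α) (suc β) + - (t * at a b (suc γ) (suc ε))) * v b)
    ≡ v a + t * (δ (toℕ a) α * extend v β) + - (t * (δ (toℕ a) γ * extend v ε))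
  apply-elementary {m} v t a α β γ ε = begin
    sumFin (λ b → (Id a b + t * at a b (suc α) (suc β) + - (t * at a b (suc γ) (suc ε))) * v b)
      ≡⟨ sumFin-cong (λ b → solve 5 (λ i t x y v → (i :+ t :* x :+ :- (t :* y)) :* v := (i :* v :+ t :* (x :* v)) :+ (:- t) :* (y :* v))
           refl (Id a b) t (at a b (suc α) (suc β)) (at a b (suc γ) (suc ε)) (v b)) ⟩
    sumFin (λ b → (Id a b * v b + t * (at a b (suc α) (suc β) * v b)) + (- t) * (at a b (suc γ) (suc ε) * v b))
      ≡⟨ trans (sumFin-+ {m} _ _) (cong₂ _+_ (trans (sumFin-+ {m} _ _) (cong₂ _+_ (apply-Id v a) (sumFin-*ˡ {m} t _))) (sumFin-*ˡ {m} (- t) _)) ⟩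
    v a + t * sumFin (λ b → at a b (suc α) (suc β) * v b) + (- t) * sumFin (λ b → at a b (suc γ) (suc ε) * v b)
      ≡⟨ cong₂ (λ x y → v a + t * x + (- t) * y) (apply-at v a α β) (apply-at v a γ ε) ⟩
    v a + t * (δ (toℕ a) α * extend v β) + (- t) * (δ (toℕ a) γ * extend v ε)
      ≡⟨ cong (v a + t * (δ (toℕ a) α * extend v β) +_) (sym (-‿distribˡ-* _ _)) ⟩
    v a + t * (δ (toℕ a) α * extend v β) + - (t * (δ (toℕ a) γ * extend v ε)) ∎

  apply-xgen-shear : ∀ {n i} t v a → suc i ℕ.< n → apply (xgen n (suc i) t) v a
    ≡ v a + t * (δ (toℕ a) i * extend v (suc i)) + - (t * (δ (toℕ a) (n ℕ.+ suc i) * extend v (n ℕ.+ i)))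
  apply-xgen-shear {n} {i} t v a 1+i<n with suc i ≡ᵇ n in eq
  ... | true  = contradiction (ℕₚ.≡ᵇ⇒≡ (suc i) n (subst T (sym eq) tt)) (ℕₚ.<⇒≢ 1+i<n)
  -- `at` is 1-based; the rewrites expose the `suc` that `apply-elementary` strips off.
  ... | false rewrite ℕₚ.+-suc n (suc i) | ℕₚ.+-suc n i = apply-elementary v t a i (suc i) (suc (n ℕ.+ i)) (n ℕ.+ i)

  apply-xgen-bump : ∀ {k} t v a → let n = suc (suc k) in apply (xgen n n t) v a
    ≡ v a + t * (δ (toℕ a) k * extend v (n ℕ.+ suc k)) + - (t * (δ (toℕ a) (suc k) * extend v (n ℕ.+ k)))
  apply-xgen-bump {k} t v a with k ≡ᵇ k in eq
  ... | false = contradiction (subst T eq (ℕₚ.≡⇒≡ᵇ k k refl)) λ()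
  ... | true rewrite ℕₚ.+-suc k (suc k) | ℕₚ.+-suc k k = apply-elementary v t a k (suc (suc (suc (k ℕ.+ k)))) (suc k) (suc (suc (k ℕ.+ k)))

  extend-pointwise : ∀ {m} {v w : Fin m → Carrier} {g : ℕ → Carrier} → (∀ a → w a ≡ v a + g (toℕ a)) →
    ∀ {j} → j ℕ.< m → extend w j ≡ extend v j + g j
  extend-pointwise {v = v} {w} {g} eq j<m = subst (λ j → extend w j ≡ extend v j + g j) (Finₚ.toℕ-fromℕ< j<m)
    (trans (extend-toℕ w i) (trans (eq i) (cong (_+ g (toℕ i)) (sym (extend-toℕ v i)))))
    where i = fromℕ< j<m

  -- Sign-twisted halves of a column: [Id | A] v = 0 becomes upper v ≡ B · lower v
  -- for the matrix B with entries - (-1)^{a+b} A_{ab}.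
  upper lower : ∀ n → (Fin (n ℕ.+ n) → Carrier) → ℕ → Carrier
  upper n v a = neg1^ a * extend v a
  lower n v b = neg1^ b * extend v (n ℕ.+ b)

  row : ∀ n → Matrix → (ℕ → Carrier) → ℕ → Carrier
  row n B q a = sumFin {n} (λ b → B a (toℕ b) * q (toℕ b))

  -- Membership of a twisted vector in the kernel of [Id | -B]. Following such vectors through the
  -- product takes the place of row-reducing the matrix.
  Solves : ∀ n → Matrix → (ℕ → Carrier) → (ℕ → Carrier) → Set
  Solves n B p q = ∀ {a} → a ℕ.< n → p a ≡ row n B q a

  row-δ : ∀ n B q {j a} c → j ℕ.< n →
    row n B (λ b → q b + c * δ b j) a ≡ row n B q a + c * B a j
  row-δ n B q {j} {a} c j<n = begin
    row n B (λ b → q b + c * δ b j) a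
      ≡⟨ sumFin-cong {n} (λ b → solve 4 (λ x y c d → x :* (y :+ c :* d) := x :* y :+ c :* (d :* x)) refl _ _ _ _) ⟩
    sumFin {n} (λ b → B a (toℕ b) * q (toℕ b) + c * (δ (toℕ b) j * B a (toℕ b)))
      ≡⟨ trans (sumFin-+ {n} _ _) (cong (row n B q a +_) (sumFin-*ˡ {n} c _)) ⟩
    row n B q a + c * sumFin {n} (λ b → δ (toℕ b) j * B a (toℕ b))
      ≡⟨ cong (λ z → row n B q a + c * z) (trans (sumFin-δ {n} j _) (extend-∘toℕ (B a) j<n)) ⟩
    row n B q a + c * B a j ∎

  row-shear : ∀ n B q {i} t a → i ℕ.< n →
    row n (shear i t B) q a ≡ row n B q a + t * (δ a i * row n B q (suc i)) + t * (B a (suc i) * q i)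
  row-shear n B q {i} t a i<n = begin
    row n (shear i t B) q a
      ≡⟨ sumFin-cong {n} (λ b → solve 7 (λ x t d y e z q → (x :+ t :* (d :* y) :+ t :* (e :* z)) :* q :=
           (x :* q :+ t :* d :* (y :* q)) :+ t :* z :* (e :* q)) refl _ _ _ _ _ _ _) ⟩
    sumFin {n} (λ b → (B a (toℕ b) * q (toℕ b) + t * δ a i * (B (suc i) (toℕ b) * q (toℕ b)))
                      + t * B a (suc i) * (δ (toℕ b) i * q (toℕ b)))
      ≡⟨ trans (sumFin-+ {n} _ _) (cong₂ _+_
           (trans (sumFin-+ {n} _ _) (cong (row n B q a +_) (sumFin-*ˡ {n} (t * δ a i) _)))
           (trans (sumFin-*ˡ {n} (t * B a (suc i)) _) (cong (t * B a (suc i) *_) (trans (sumFin-δ {n} i _) (extend-∘toℕ q i<n))))) ⟩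
    row n B q a + t * δ a i * row n B q (suc i) + t * B a (suc i) * q i
      ≡⟨ cong₂ (λ x y → row n B q a + x + y) (*-assoc _ _ _) (*-assoc _ _ _) ⟩
    row n B q a + t * (δ a i * row n B q (suc i)) + t * (B a (suc i) * q i) ∎

  row-bump : ∀ n k B q t a → suc k ℕ.< n →
    row n (bump k t B) q a ≡ row n B q a + t * (δ a k * q (suc k)) + - (t * (δ a (suc k) * q k))
  row-bump n k B q t a 1+k<n = begin
    row n (bump k t B) q a
      ≡⟨ sumFin-cong {n} (λ b → solve 7 (λ x t d e d′ e′ q → (x :+ t :* (d :* e :+ :- (d′ :* e′))) :* q :=
           (x :* q :+ t :* d :* (e :* q)) :+ (:- (t :* d′)) :* (e′ :* q)) refl _ _ _ _ _ _ _) ⟩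
    sumFin {n} (λ b → (B a (toℕ b) * q (toℕ b) + t * δ a k * (δ (toℕ b) (suc k) * q (toℕ b)))
                      + (- (t * δ a (suc k))) * (δ (toℕ b) k * q (toℕ b)))
      ≡⟨ trans (sumFin-+ {n} _ _) (cong₂ _+_
           (trans (sumFin-+ {n} _ _) (cong (row n B q a +_) (trans (sumFin-*ˡ {n} (t * δ a k) _)
             (cong (t * δ a k *_) (trans (sumFin-δ {n} (suc k) _) (extend-∘toℕ {n} q 1+k<n))))))
           (trans (sumFin-*ˡ {n} (- (t * δ a (suc k))) _)
             (cong (- (t * δ a (suc k)) *_) (trans (sumFin-δ {n} k _) (extend-∘toℕ {n} q (ℕₚ.<-trans (ℕₚ.n<1+n k) 1+k<n)))))) ⟩
    row n B q a + t * δ a k * q (suc k) + - (t * δ a (suc k)) * q k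
      ≡⟨ solve 6 (λ r t d x e y → r :+ t :* d :* x :+ (:- (t :* e)) :* y := r :+ t :* (d :* x) :+ :- (t :* (e :* y))) refl _ _ _ _ _ _ ⟩
    row n B q a + t * (δ a k * q (suc k)) + - (t * (δ a (suc k) * q k)) ∎

  -- Brought to the other side, the change of the upper half adds a multiple of row `suc i` to row
  -- `i`, and the change of the lower half adds a multiple of column `suc i` to column `i`: the two
  -- new terms of `shear`.
  solves-shear : ∀ n B {p q p′ q′ : ℕ → Carrier} {i} t → suc i ℕ.< n → B (suc i) (suc i) ≡ 0# →
    (∀ {a} → a ℕ.< n → p′ a ≡ p a + - (t * (δ a i * p (suc i)))) →
    (∀ {b} → b ℕ.< n → q′ b ≡ q b + t * q i * δ b (suc i)) →
    Solves n B p′ q′ → Solves n (shear i t B) p q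
  solves-shear n B {p} {q} {p′} {q′} {i} t 1+i<n diag p′≡ q′≡ sol {a} a<n = begin
    p a
      ≡⟨ solve 2 (λ x y → x := (x :+ :- y) :+ y) refl _ _ ⟩
    p a + - (t * (δ a i * p (suc i))) + t * (δ a i * p (suc i))
      ≡⟨ cong₂ (λ x y → x + t * (δ a i * y)) (trans (sym (p′≡ a<n)) (equation a<n)) p-1+i ⟩
    row n B q a + t * q i * B a (suc i) + t * (δ a i * row n B q (suc i))
      ≡⟨ solve 5 (λ r t q b x → r :+ t :* q :* b :+ x := r :+ x :+ t :* (b :* q)) refl _ _ _ _ _ ⟩
    row n B q a + t * (δ a i * row n B q (suc i)) + t * (B a (suc i) * q i)
      ≡⟨ sym (row-shear n B q t a (ℕₚ.<-trans (ℕₚ.n<1+n i) 1+i<n)) ⟩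
    row n (shear i t B) q a ∎
    where
    equation : ∀ {a} → a ℕ.< n → p′ a ≡ row n B q a + t * q i * B a (suc i)
    equation {a} a<n = trans (sol a<n) (trans
      (sumFin-cong {n} (λ b → cong (B a (toℕ b) *_) (q′≡ (Finₚ.toℕ<n b))))
      (row-δ n B q (t * q i) 1+i<n))
    -- Entry `suc i` of the upper half does not change, and the change of the lower half meets row
    -- `suc i` only in its zero diagonal entry.
    p-1+i : p (suc i) ≡ row n B q (suc i)
    p-1+i = begin
      p (suc i)
        ≡⟨ sym (trans (cong (λ z → p (suc i) + - (t * (z * p (suc i)))) (δ-≢ (ℕₚ.1+n≢n {i})))
             (solve 3 (λ x t y → x :+ :- (t :* (:0 :* y)) := x) refl _ _ _)) ⟩
      p (suc i) + - (t * (δ (suc i) i * p (suc i)))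
        ≡⟨ trans (sym (p′≡ 1+i<n)) (equation 1+i<n) ⟩
      row n B q (suc i) + t * q i * B (suc i) (suc i)
        ≡⟨ trans (cong (λ z → row n B q (suc i) + t * q i * z) diag) (trans (cong (row n B q (suc i) +_) (zeroʳ _)) (+-identityʳ _)) ⟩
      row n B q (suc i) ∎

  solves-bump : ∀ k B {p q p′ q′ : ℕ → Carrier} t → let n = suc (suc k) in
    (∀ {a} → a ℕ.< n → p′ a ≡ p a + - (t * (δ a k * q (suc k))) + t * (δ a (suc k) * q k)) →
    (∀ {b} → b ℕ.< n → q′ b ≡ q b) →
    Solves n B p′ q′ → Solves n (bump k t B) p q
  solves-bump k B {p} {q} {p′} {q′} t p′≡ q′≡ sol {a} a<n = begin
    p a
      ≡⟨ solve 3 (λ p x y → p := (p :+ :- x :+ y) :+ x :+ :- y) refl _ _ _ ⟩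
    (p a + - (t * (δ a k * q (suc k))) + t * (δ a (suc k) * q k)) + t * (δ a k * q (suc k)) + - (t * (δ a (suc k) * q k))
      ≡⟨ cong (λ z → z + t * (δ a k * q (suc k)) + - (t * (δ a (suc k) * q k))) (trans (sym (p′≡ a<n)) (trans (sol a<n)
           (sumFin-cong {suc (suc k)} (λ b → cong (B a (toℕ b) *_) (q′≡ (Finₚ.toℕ<n b)))))) ⟩
    row (suc (suc k)) B q a + t * (δ a k * q (suc k)) + - (t * (δ a (suc k) * q k))
      ≡⟨ sym (row-bump (suc (suc k)) k B q t a (ℕₚ.n<1+n (suc k))) ⟩
    row (suc (suc k)) (bump k t B) q a ∎

  Skew : Matrix → Set
  Skew B = ∀ a b → B a b ≡ - B b a

  skew-diag : ∀ {B} → Skew B → ∀ a → B a a ≡ 0#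
  skew-diag skew a = x≡-x⇒x≡0 (skew a a)

  shear-skew : ∀ {i t B} → Skew B → Skew (shear i t B)
  shear-skew {i} {t} {B} skew a b
    rewrite skew a b | skew (suc i) b | skew a (suc i) =
    solve 6 (λ x t d y e z → :- x :+ t :* (d :* (:- y)) :+ t :* (e :* (:- z)) := :- (x :+ t :* (e :* z) :+ t :* (d :* y))) refl _ _ _ _ _ _

  bump-skew : ∀ {k t B} → Skew B → Skew (bump k t B)
  bump-skew {k} {t} {B} skew a b rewrite skew a b =
    solve 6 (λ x t d e d′ e′ → :- x :+ t :* (d :* e :+ :- (d′ :* e′)) := :- (x :+ t :* (e′ :* d′ :+ :- (e :* d)))) refl _ _ _ _ _ _

  δ-transport : ∀ a i (f : ℕ → Carrier) → f a * δ a i ≡ f i * δ a i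
  δ-transport a i f with a ℕ.≟ i
  ... | yes refl = refl
  ... | no a≢i rewrite δ-≢ a≢i = trans (zeroʳ _) (sym (zeroʳ _))

  -- Here the twist pays off: `i` and `suc i` carry opposite signs, so the `+ t` of x_i in the upper
  -- half becomes `- t` and its `- t` in the lower half becomes `+ t`, as `solves-shear` expects.
  solves-xgen-shear : ∀ n B {i} t v → suc i ℕ.< n → Skew B →
    Solves n B (upper n (apply (xgen n (suc i) t) v)) (lower n (apply (xgen n (suc i) t) v)) →
    Solves n (shear i t B) (upper n v) (lower n v)
  solves-xgen-shear n B {i} t v 1+i<n skew = solves-shear n B t 1+i<n (skew-diag skew (suc i)) upper≡ lower≡
    where
    w = apply (xgen n (suc i) t) v
    change : ℕ → Carrier
    change j = t * (δ j i * extend v (suc i)) + - (t * (δ j (n ℕ.+ suc i) * extend v (n ℕ.+ i)))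
    entry : ∀ {j} → j ℕ.< n ℕ.+ n → extend w j ≡ extend v j + change j
    entry = extend-pointwise {v = v} {w} {change} (λ a → trans (apply-xgen-shear t v a 1+i<n) (+-assoc _ _ _))
    upper≡ : ∀ {a} → a ℕ.< n → upper n w a ≡ upper n v a + - (t * (δ a i * upper n v (suc i)))
    upper≡ {a} a<n
      rewrite entry (ℕₚ.<-≤-trans a<n (ℕₚ.m≤m+n n n))
            | δ-≢ {a} {n ℕ.+ suc i} (ℕₚ.<⇒≢ (ℕₚ.<-≤-trans a<n (ℕₚ.m≤m+n n (suc i)))) =
      trans (solve 6 (λ s x t d y z → s :* (x :+ (t :* (d :* y) :+ :- (t :* (:0 :* z)))) := s :* x :+ t :* (s :* d) :* y) refl _ _ _ _ _ _)
        (trans (cong (λ z → neg1^ a * extend v a + t * z * extend v (suc i)) (δ-transport a i neg1^))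
          (solve 5 (λ x t s d y → x :+ t :* (s :* d) :* y := x :+ :- (t :* (d :* ((:- s) :* y)))) refl _ _ _ _ _))
    lower≡ : ∀ {b} → b ℕ.< n → lower n w b ≡ lower n v b + t * lower n v i * δ b (suc i)
    lower≡ {b} b<n
      rewrite entry (ℕₚ.+-monoʳ-< n b<n)
            | δ-≢ {n ℕ.+ b} {i} (λ eq → ℕₚ.<⇒≢ (ℕₚ.<-≤-trans (ℕₚ.<-trans (ℕₚ.n<1+n i) 1+i<n) (ℕₚ.m≤m+n n b)) (sym eq))
            | ≡ᵇ-+ˡ n b (suc i) =
      trans (solve 6 (λ s x t d y z → s :* (x :+ (t :* (:0 :* z) :+ :- (t :* (d :* y)))) := s :* x :+ :- (t :* (s :* d) :* y)) refl _ _ _ _ _ _)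
        (trans (cong (λ z → neg1^ b * extend v (n ℕ.+ b) + - (t * z * extend v (n ℕ.+ i))) (δ-transport b (suc i) neg1^))
          (solve 5 (λ x t s d y → x :+ :- (t :* ((:- s) :* d) :* y) := x :+ t :* (s :* y) :* d) refl _ _ _ _ _))

  solves-xgen-bump : ∀ k B t v → let n = suc (suc k) in
    Solves n B (upper n (apply (xgen n n t) v)) (lower n (apply (xgen n n t) v)) →
    Solves n (bump k t B) (upper n v) (lower n v)
  solves-xgen-bump k B t v = solves-bump k B t upper≡ lower≡
    where
    n = suc (suc k)
    w = apply (xgen n n t) v
    change : ℕ → Carrier
    change j = t * (δ j k * extend v (n ℕ.+ suc k)) + - (t * (δ j (suc k) * extend v (n ℕ.+ k)))
    entry : ∀ {j} → j ℕ.< n ℕ.+ n → extend w j ≡ extend v j + change j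
    entry = extend-pointwise {v = v} {w} {change} (λ a → trans (apply-xgen-bump {k} t v a) (+-assoc _ _ _))
    upper≡ : ∀ {a} → a ℕ.< n → upper n w a ≡ upper n v a + - (t * (δ a k * lower n v (suc k))) + t * (δ a (suc k) * lower n v k)
    upper≡ {a} a<n = begin
      neg1^ a * extend w a
        ≡⟨ cong (neg1^ a *_) (entry (ℕₚ.<-≤-trans a<n (ℕₚ.m≤m+n n n))) ⟩
      neg1^ a * (extend v a + change a)
        ≡⟨ solve 7 (λ s x t d y e z → s :* (x :+ (t :* (d :* y) :+ :- (t :* (e :* z)))) :=
             s :* x :+ t :* (s :* d) :* y :+ :- (t :* (s :* e) :* z)) refl _ _ _ _ _ _ _ ⟩
      upper n v a + t * (neg1^ a * δ a k) * extend v (n ℕ.+ suc k) + - (t * (neg1^ a * δ a (suc k)) * extend v (n ℕ.+ k))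
        ≡⟨ cong₂ (λ x y → upper n v a + t * x * extend v (n ℕ.+ suc k) + - (t * y * extend v (n ℕ.+ k)))
             (δ-transport a k neg1^) (δ-transport a (suc k) neg1^) ⟩
      upper n v a + t * (neg1^ k * δ a k) * extend v (n ℕ.+ suc k) + - (t * (- neg1^ k * δ a (suc k)) * extend v (n ℕ.+ k))
        ≡⟨ solve 7 (λ x t s d y e z → x :+ t :* (s :* d) :* y :+ :- (t :* ((:- s) :* e) :* z) :=
             x :+ :- (t :* (d :* ((:- s) :* y))) :+ t :* (e :* (s :* z))) refl _ _ _ _ _ _ _ ⟩
      upper n v a + - (t * (δ a k * lower n v (suc k))) + t * (δ a (suc k) * lower n v k) ∎
    lower≡ : ∀ {b} → b ℕ.< n → lower n w b ≡ lower n v b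
    lower≡ {b} b<n
      rewrite entry (ℕₚ.+-monoʳ-< n b<n)
            | δ-≢ {n ℕ.+ b} {k} (λ eq → ℕₚ.<⇒≢ (ℕₚ.<-≤-trans (ℕₚ.m<n⇒m<1+n (ℕₚ.n<1+n k)) (ℕₚ.m≤m+n n b)) (sym eq))
            | δ-≢ {n ℕ.+ b} {suc k} (λ eq → ℕₚ.<⇒≢ (ℕₚ.<-≤-trans (ℕₚ.n<1+n (suc k)) (ℕₚ.m≤m+n n b)) (sym eq)) =
      cong (neg1^ b *_) (solve 4 (λ x t y z → x :+ (t :* (:0 :* y) :+ :- (t :* (:0 :* z))) := x) refl _ _ _ _)

  solves-cong : ∀ n B {v w} → (∀ a → v a ≡ w a) → Solves n B (upper n v) (lower n v) → Solves n B (upper n w) (lower n w)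
  solves-cong n B {v} {w} v≗w sol {a} a<n = trans (cong (neg1^ a *_) (sym (extend-cong v≗w a))) (trans (sol a<n)
    (sumFin-cong {n} (λ b → cong (λ z → B a (toℕ b) * (neg1^ (toℕ b) * z)) (extend-cong v≗w (n ℕ.+ toℕ b)))))
    where
    extend-cong : ∀ {m} {v w : Fin m → Carrier} → (∀ a → v a ≡ w a) → ∀ j → extend v j ≡ extend w j
    extend-cong {zero}  eq j       = refl
    extend-cong {suc m} eq zero    = eq Fin.zero
    extend-cong {suc m} eq (suc j) = extend-cong (eq ∘ Fin.suc) j

  run : ∀ n {w} → All (Letter n) w → (Fin (length w) → Carrier) → Matrix → Matrix
  run n []               t B = B
  run n (shearing {i} _ ∷ ls) t B = run n ls (t ∘ Fin.suc) (shear i (t Fin.zero) B)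
  run n (bumping {k} _ ∷ ls)  t B = run n ls (t ∘ Fin.suc) (bump k (t Fin.zero) B)

  run-Run : ∀ n {w} (ls : All (Letter n) w) t → (∀ k → 0# < t k) → ∀ B → Run n w B (run n ls t B)
  run-Run n []                   t t>0 B = []
  run-Run n (shearing 1+i<n ∷ ls) t t>0 B = shearing 1+i<n (t>0 Fin.zero) ∷ run-Run n ls (t ∘ Fin.suc) (t>0 ∘ Fin.suc) _
  run-Run n (bumping n≡2+k ∷ ls)  t t>0 B = bumping n≡2+k (t>0 Fin.zero) ∷ run-Run n ls (t ∘ Fin.suc) (t>0 ∘ Fin.suc) _

  -- The product is peeled from the left: each letter leaves the vector and enters the matrix as a
  -- move, so the moves happen in the order of the word.
  run-solves : ∀ n {w} (ls : All (Letter n) w) t {B} v → Skew B →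
    Solves n B (upper n (apply (prodWord n w t) v)) (lower n (apply (prodWord n w t) v)) →
    Solves n (run n ls t B) (upper n v) (lower n v)
  run-solves n []                   t {B} v skew sol = solves-cong n B (apply-Id v) sol
  run-solves n {_ ∷ w} (shearing {i} 1+i<n ∷ ls) t {B} v skew sol = run-solves n ls (t ∘ Fin.suc) v (shear-skew {B = B} skew)
    (solves-xgen-shear n B (t Fin.zero) _ 1+i<n skew (solves-cong n B (apply-⊗ (xgen n (suc i) (t Fin.zero)) (prodWord n w (t ∘ Fin.suc)) v) sol))
  run-solves n {_ ∷ w} (bumping {k} refl ∷ ls) t {B} v skew sol = run-solves n ls (t ∘ Fin.suc) v (bump-skew {B = B} skew)
    (solves-xgen-bump k B (t Fin.zero) _ (solves-cong n B (apply-⊗ (xgen n n (t Fin.zero)) (prodWord n w (t ∘ Fin.suc)) v) sol))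

  totallyPositive⇒run : ∀ {n} (A : Mat n n) → TotallyPositive A → ∃ λ B → Run n (word n) zeroMatrix B ×
    (∀ a c → A a c ≡ neg1^ (suc (toℕ a ℕ.+ toℕ c)) * B (toℕ a) (toℕ c))
  totallyPositive⇒run {n} A (_ , t , t>0 , LA≡R) = B , run-Run n (word-letters n) t t>0 zeroMatrix , entries
    where
    B = run n (word-letters n) t zeroMatrix
    module _ (c : Fin n) where
      -- Column `c` of `A` above minus the unit vector: the first `n` rows of the product send it to
      -- column `c` of L A - R, which is zero.
      v : Fin (n ℕ.+ n) → Carrier
      v j = [ (λ a → A a c) , (λ b → - δ (toℕ b) (toℕ c)) ]′ (splitAt n j)
      G = prodWord n (word n) t
      top-vanishes : ∀ a → apply G v (a ↑ˡ n) ≡ 0#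
      top-vanishes a = begin
        apply G v (a ↑ˡ n)
          ≡⟨ sumFin-split n (λ b → G (a ↑ˡ n) b * v b) ⟩
        sumFin (λ b → G (a ↑ˡ n) (b ↑ˡ n) * v (b ↑ˡ n)) + sumFin (λ b → G (a ↑ˡ n) (n ↑ʳ b) * v (n ↑ʳ b))
          ≡⟨ cong₂ _+_
               (trans (sumFin-cong (λ b → cong (λ z → Lblock n t a b * [ (λ a → A a c) , _ ]′ z) (Finₚ.splitAt-↑ˡ n b n))) (LA≡R a c))
               (begin
                 sumFin (λ b → Rblock n t a b * v (n ↑ʳ b))
                   ≡⟨ sumFin-cong (λ b → trans (cong (λ z → Rblock n t a b * [ (λ a → A a c) , _ ]′ z) (Finₚ.splitAt-↑ʳ n n b))
                        (trans (solve 2 (λ r d → r :* (:- d) := :- (d :* r)) refl _ _)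
                          (trans (cong (-_) (sym (*-idˡ _))) (-‿distribˡ-* _ _)))) ⟩
                 sumFin (λ b → (- 1#) * (δ (toℕ b) (toℕ c) * Rblock n t a b))
                   ≡⟨ trans (sumFin-*ˡ {n} (- 1#) _) (cong (- 1# *_) (trans (sumFin-δ (toℕ c) (Rblock n t a)) (extend-toℕ (Rblock n t a) c))) ⟩
                 (- 1#) * Rblock n t a c
                   ≡⟨ trans (sym (-‿distribˡ-* _ _)) (cong (-_) (*-idˡ _)) ⟩
                 - Rblock n t a c ∎) ⟩
        Rblock n t a c + - Rblock n t a c
          ≡⟨ -‿inverseʳ _ ⟩
        0# ∎
      -- For the zero matrix, solving means that the upper half vanishes; this is the starting point
      -- for `run-solves`.
      sol : Solves n zeroMatrix (upper n (apply G v)) (lower n (apply G v))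
      sol {a} a<n = begin
        neg1^ a * extend (apply G v) a
          ≡⟨ cong (λ j → neg1^ a * extend (apply G v) j) (sym (trans (Finₚ.toℕ-↑ˡ (fromℕ< a<n) n) (Finₚ.toℕ-fromℕ< a<n))) ⟩
        neg1^ a * extend (apply G v) (toℕ (fromℕ< a<n ↑ˡ n))
          ≡⟨ cong (neg1^ a *_) (trans (extend-toℕ (apply G v) (fromℕ< a<n ↑ˡ n)) (top-vanishes (fromℕ< a<n))) ⟩
        neg1^ a * 0#
          ≡⟨ zeroʳ _ ⟩
        0#
          ≡⟨ sym (trans (sumFin-cong {n} (λ b → zeroˡ _)) (sumFin-0 n)) ⟩
        row n zeroMatrix (lower n (apply G v)) a ∎
      upper-v : ∀ a → upper n v (toℕ a) ≡ neg1^ (toℕ a) * A a c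
      upper-v a = cong (neg1^ (toℕ a) *_) (begin
        extend v (toℕ a)          ≡⟨ cong (extend v) (sym (Finₚ.toℕ-↑ˡ a n)) ⟩
        extend v (toℕ (a ↑ˡ n))   ≡⟨ extend-toℕ v (a ↑ˡ n) ⟩
        v (a ↑ˡ n)                ≡⟨ cong [ (λ a → A a c) , _ ]′ (Finₚ.splitAt-↑ˡ n a n) ⟩
        A a c                     ∎)
      lower-v : ∀ b → lower n v (toℕ b) ≡ neg1^ (toℕ b) * - δ (toℕ b) (toℕ c)
      lower-v b = cong (neg1^ (toℕ b) *_) (begin
        extend v (n ℕ.+ toℕ b)    ≡⟨ cong (extend v) (sym (Finₚ.toℕ-↑ʳ n b)) ⟩
        extend v (toℕ (n ↑ʳ b))   ≡⟨ extend-toℕ v (n ↑ʳ b) ⟩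
        v (n ↑ʳ b)                ≡⟨ cong [ (λ a → A a c) , _ ]′ (Finₚ.splitAt-↑ʳ n n b) ⟩
        - δ (toℕ b) (toℕ c)       ∎)
    entries : ∀ a c → A a c ≡ neg1^ (suc (toℕ a ℕ.+ toℕ c)) * B (toℕ a) (toℕ c)
    entries a c = begin
      A a c
        ≡⟨ trans (sym (*-idˡ _)) (trans (cong (_* A a c) (sym (neg1^-square (toℕ a)))) (*-assoc _ _ _)) ⟩
      sa * (sa * A a c)
        ≡⟨ cong (sa *_) (trans (sym (upper-v c a)) (run-solves n (word-letters n) t (v c) (λ _ _ → sym -0#≈0#) (sol c) (Finₚ.toℕ<n a))) ⟩
      sa * row n B (lower n (v c)) (toℕ a)
        ≡⟨ cong (sa *_) (sumFin-cong {n} (λ b → trans (cong (B (toℕ a) (toℕ b) *_) (lower-v c b))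
             (solve 3 (λ x s d → x :* (s :* :- d) := d :* :- (x :* s)) refl _ _ _))) ⟩
      sa * sumFin {n} (λ b → δ (toℕ b) (toℕ c) * - (B (toℕ a) (toℕ b) * neg1^ (toℕ b)))
        ≡⟨ cong (sa *_) (trans (sumFin-δ {n} (toℕ c) _) (extend-toℕ {n} _ c)) ⟩
      sa * - (B (toℕ a) (toℕ c) * sc)
        ≡⟨ solve 3 (λ s x s′ → s :* :- (x :* s′) := :- (s :* s′) :* x) refl _ _ _ ⟩
      - (sa * sc) * B (toℕ a) (toℕ c)
        ≡⟨ cong (λ z → - z * B (toℕ a) (toℕ c)) (sym (neg1^-+ (toℕ a) (toℕ c))) ⟩
      neg1^ (suc (toℕ a ℕ.+ toℕ c)) * B (toℕ a) (toℕ c) ∎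
      where
      sa = neg1^ (toℕ a)
      sc = neg1^ (toℕ c)

-- Signs and subsets

reverse-descending : ∀ {l} → AllPairs ℕ._<_ l → Descending (reverse l)
reverse-descending []                 = []
reverse-descending {x ∷ l} (x< ∷ asc) = subst Descending (sym (unfold-reverse x l))
  (AllPairsₚ.++⁺ (reverse-descending asc) ([] ∷ [])
    (All.map (_∷ []) (All-resp-↭ (↭-sym (↭ₚ.↭-reverse l)) x<)))

smaller-of-0 : ∀ ys → smaller 0 ys ≡ 0
smaller-of-0 []       = refl
smaller-of-0 (y ∷ ys) = smaller-of-0 ys

-- `0` is inverted with every entry before it and with none after it.
inversionCount-0 : ∀ xs {ys} → All (0 ℕ.<_) xs →
  inversionCount (xs ++ 0 ∷ ys) ≡ length xs ℕ.+ inversionCount (xs ++ ys)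
inversionCount-0 [] {ys} [] = cong (ℕ._+ inversionCount ys) (smaller-of-0 ys)
inversionCount-0 (x ∷ xs) {ys} (0<x ∷ 0<xs) = trans
  (cong₂ ℕ._+_ (smaller-0 xs) (inversionCount-0 xs 0<xs))
  (solve 3 (λ s l i → (con 1 :+ s) :+ (l :+ i) := (con 1 :+ l) :+ (s :+ i)) refl
    (smaller x (xs ++ ys)) (length xs) (inversionCount (xs ++ ys)))
  where
  open +-*-Solver
  smaller-0 : ∀ xs → smaller x (xs ++ 0 ∷ ys) ≡ suc (smaller x (xs ++ ys))
  smaller-0 [] rewrite <ᵇ-true 0<x = refl
  smaller-0 (z ∷ xs) = trans (cong ((if z <ᵇ x then 1 else 0) ℕ.+_) (smaller-0 xs)) (ℕₚ.+-suc _ _)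

[1+n]C2 : ∀ n → suc n C 2 ≡ n ℕ.+ n C 2
[1+n]C2 n = trans (sym (nCk+nC[k+1]≡[n+1]C[k+1] n 1)) (cong (ℕ._+ n C 2) (nC1≡n n))

-- m(2m+1), written so that its parity, that of `m`, is visible.
[1+2m]C2 : ∀ m → suc (m ℕ.* 2) C 2 ≡ m ℕ.+ (m ℕ.* m ℕ.+ m ℕ.* m)
[1+2m]C2 zero    = refl
[1+2m]C2 (suc m) = trans ([1+n]C2 (suc (suc (m ℕ.* 2)))) (trans
  (cong (suc (suc (m ℕ.* 2)) ℕ.+_) (trans ([1+n]C2 (suc (m ℕ.* 2))) (cong (suc (m ℕ.* 2) ℕ.+_) ([1+2m]C2 m))))
  (solve 1 (λ m → (con 2 :+ m :* con 2) :+ ((con 1 :+ m :* con 2) :+ (m :+ (m :* m :+ m :* m)))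
    := (con 1 :+ m) :+ ((con 1 :+ m) :* (con 1 :+ m) :+ (con 1 :+ m) :* (con 1 :+ m))) refl m))
  where open +-*-Solver

module Subsets (ℝ : RealField) where
  open Reals ℝ using (elems; inversions)

  positions : ∀ {n} → Subset n → List ℕ
  positions I = map toℕ (elems I)

  filter-suc : ∀ {n} b (I : Subset n) xs →
    filter (λ i → T? (lookup (b ∷ I) i)) (map Fin.suc xs) ≡ map Fin.suc (filter (λ i → T? (lookup I i)) xs)
  filter-suc b I []       = refl
  filter-suc b I (x ∷ xs) with lookup I x
  ... | true  = cong (Fin.suc x ∷_) (filter-suc b I xs)
  ... | false = filter-suc b I xs

  filter-tail : ∀ {n} b (I : Subset n) →
    map toℕ (filter (λ i → T? (lookup (b ∷ I) i)) (tabulate Fin.suc)) ≡ map suc (positions I)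
  filter-tail {n} b I = begin
    map toℕ (filter (λ i → T? (lookup (b ∷ I) i)) (tabulate Fin.suc))
      ≡⟨ cong (λ xs → map toℕ (filter (λ i → T? (lookup (b ∷ I) i)) xs)) (sym (map-tabulate (λ i → i) Fin.suc)) ⟩
    map toℕ (filter (λ i → T? (lookup (b ∷ I) i)) (map Fin.suc (allFin n)))
      ≡⟨ cong (map toℕ) (filter-suc b I (allFin n)) ⟩
    map toℕ (map Fin.suc (elems I))
      ≡⟨ trans (sym (map-∘ (elems I))) (map-∘ (elems I)) ⟩
    map suc (positions I) ∎
    where open ≡-Reasoning

  positions-true : ∀ {n} (I : Subset n) → positions (true ∷ I) ≡ 0 ∷ map suc (positions I)
  positions-true I = cong (0 ∷_) (filter-tail true I)

  positions-false : ∀ {n} (I : Subset n) → positions (false ∷ I) ≡ map suc (positions I)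
  positions-false I = filter-tail false I

  length-positions : ∀ {n} (I : Subset n) → length (positions I) ≡ ∣ I ∣
  length-positions []          = refl
  length-positions (true ∷ I)  = trans (cong length (positions-true I)) (cong suc (trans (length-map suc (positions I)) (length-positions I)))
  length-positions (false ∷ I) = trans (cong length (positions-false I)) (trans (length-map suc (positions I)) (length-positions I))

  positions-ascending : ∀ {n} (I : Subset n) → AllPairs ℕ._<_ (positions I)
  positions-ascending []          = []
  positions-ascending (true ∷ I)  = subst (AllPairs ℕ._<_) (sym (positions-true I))
    (Allₚ.map⁺ (All.universal (λ _ → ℕ.z<s) (positions I))
      ∷ AllPairsₚ.map⁺ (AllPairs.map ℕ.s<s (positions-ascending I)))
  positions-ascending (false ∷ I) = subst (AllPairs ℕ._<_) (sym (positions-false I))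
    (AllPairsₚ.map⁺ (AllPairs.map ℕ.s<s (positions-ascending I)))

  positions-bounded : ∀ {n} (I : Subset n) → All (ℕ._< n) (positions I)
  positions-bounded I = Allₚ.map⁺ (All.universal Finₚ.toℕ<n (elems I))

  inversionCount-map-suc : ∀ xs → inversionCount (map suc xs) ≡ inversionCount xs
  inversionCount-map-suc xs = inversionCount-map suc {λ _ → ⊤} (λ _ _ → ℕ.s<s) xs (All.universal _ xs)

  sum-map-suc : ∀ xs → sum (map suc xs) ≡ sum xs ℕ.+ length xs
  sum-map-suc []       = refl
  sum-map-suc (x ∷ xs) = trans (cong (suc x ℕ.+_) (sum-map-suc xs))
    (solve 3 (λ x s l → (con 1 :+ x) :+ (s :+ l) := (x :+ s) :+ (con 1 :+ l)) refl x (sum xs) (length xs))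
    where open +-*-Solver

  -- The k-th element i of `I` is inverted with the i - k smaller elements of the complement; the
  -- additive form avoids subtraction. A new least element in `I` raises both the sum and the
  -- binomial coefficient by |I| + 1 and creates no inversion; one in the complement raises the sum
  -- and the inversions by |I|.
  inversionCount-split : ∀ {n} (I : Subset n) →
    inversionCount (positions I ++ positions (∁ I)) ℕ.+ suc ∣ I ∣ C 2 ≡ sum (map suc (positions I))
  inversionCount-split []          = refl
  inversionCount-split (true ∷ I) = begin
    inversionCount (positions (true ∷ I) ++ positions (false ∷ ∁ I)) ℕ.+ suc (suc ∣ I ∣) C 2
      ≡⟨ cong₂ (λ xs ys → inversionCount (xs ++ ys) ℕ.+ suc (suc ∣ I ∣) C 2) (positions-true I) (positions-false (∁ I)) ⟩
    smaller 0 (map suc X ++ map suc Y) ℕ.+ inversionCount (map suc X ++ map suc Y) ℕ.+ suc (suc ∣ I ∣) C 2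
      ≡⟨ cong₂ ℕ._+_ (cong₂ ℕ._+_ (smaller-of-0 (map suc X ++ map suc Y))
           (trans (cong inversionCount (sym (map-++ suc X Y))) (inversionCount-map-suc (X ++ Y))))
           ([1+n]C2 (suc ∣ I ∣)) ⟩
    inversionCount (X ++ Y) ℕ.+ (suc ∣ I ∣ ℕ.+ suc ∣ I ∣ C 2)
      ≡⟨ solve 3 (λ i l c → i :+ (con 1 :+ l :+ c) := con 1 :+ ((i :+ c) :+ l)) refl (inversionCount (X ++ Y)) ∣ I ∣ (suc ∣ I ∣ C 2) ⟩
    suc ((inversionCount (X ++ Y) ℕ.+ suc ∣ I ∣ C 2) ℕ.+ ∣ I ∣)
      ≡⟨ cong suc (cong₂ ℕ._+_ (inversionCount-split I) (sym (trans (length-map suc X) (length-positions I)))) ⟩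
    suc (sum (map suc X) ℕ.+ length (map suc X))
      ≡⟨ cong suc (sym (sum-map-suc (map suc X))) ⟩
    suc (sum (map suc (map suc X)))
      ≡⟨ cong (sum ∘ map suc) (sym (positions-true I)) ⟩
    sum (map suc (positions (true ∷ I))) ∎
    where
    open ≡-Reasoning
    open +-*-Solver
    X = positions I
    Y = positions (∁ I)
  inversionCount-split (false ∷ I) = begin
    inversionCount (positions (false ∷ I) ++ positions (true ∷ ∁ I)) ℕ.+ suc ∣ I ∣ C 2
      ≡⟨ cong₂ (λ xs ys → inversionCount (xs ++ ys) ℕ.+ suc ∣ I ∣ C 2) (positions-false I) (positions-true (∁ I)) ⟩
    inversionCount (map suc X ++ 0 ∷ map suc Y) ℕ.+ suc ∣ I ∣ C 2
      ≡⟨ cong (ℕ._+ suc ∣ I ∣ C 2) (trans (inversionCount-0 (map suc X) (Allₚ.map⁺ (All.universal (λ _ → ℕ.z<s) X)))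
           (cong (length (map suc X) ℕ.+_) (trans (cong inversionCount (sym (map-++ suc X Y))) (inversionCount-map-suc (X ++ Y))))) ⟩
    length (map suc X) ℕ.+ inversionCount (X ++ Y) ℕ.+ suc ∣ I ∣ C 2
      ≡⟨ solve 3 (λ l i c → l :+ i :+ c := (i :+ c) :+ l) refl (length (map suc X)) (inversionCount (X ++ Y)) (suc ∣ I ∣ C 2) ⟩
    inversionCount (X ++ Y) ℕ.+ suc ∣ I ∣ C 2 ℕ.+ length (map suc X)
      ≡⟨ cong (ℕ._+ length (map suc X)) (inversionCount-split I) ⟩
    sum (map suc X) ℕ.+ length (map suc X)
      ≡⟨ sym (sum-map-suc (map suc X)) ⟩
    sum (map suc (map suc X))
      ≡⟨ cong (sum ∘ map suc) (sym (positions-false I)) ⟩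
    sum (map suc (positions (false ∷ I))) ∎
    where
    open ≡-Reasoning
    open +-*-Solver
    X = positions I
    Y = positions (∁ I)

  inversions-toℕ : ∀ {n} (σ : List (Fin n)) → inversions σ ≡ inversionCount (map toℕ σ)
  inversions-toℕ []       = refl
  inversions-toℕ (x ∷ xs) = cong₂ ℕ._+_ (count xs) (inversions-toℕ xs)
    where
    count : ∀ ys → length (filter (λ y → T? (suc (toℕ y) ≤ᵇ toℕ x)) ys) ≡ smaller (toℕ x) (map toℕ ys)
    count []       = refl
    count (y ∷ ys) with toℕ y <ᵇ toℕ x
    ... | true  = cong suc (count ys)
    ... | false = count ys

  sumIdx-sum : ∀ {n} (I : Subset n) → sumIdx (map (λ i → suc (toℕ i)) (elems I)) ≡ sum (map suc (positions I))
  sumIdx-sum I = cong sum (map-∘ (elems I))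

  -- The exponent is the inversion number itself and not merely congruent to it, so one equation
  -- serves both claims of the theorem.
  index-exponent : ∀ {n} (I : Subset n) →
    ℤ.+ sumIdx (map (λ i → suc (toℕ i)) (elems I)) ℤ.- ℤ.+ (suc ∣ I ∣ C 2)
    ≡ ℤ.+ inversionCount (positions I ++ positions (∁ I))
  index-exponent I = begin
    ℤ.+ sumIdx (map (λ i → suc (toℕ i)) (elems I)) ℤ.- ℤ.+ k
      ≡⟨ cong (λ s → ℤ.+ s ℤ.- ℤ.+ k) (trans (sumIdx-sum I) (sym (inversionCount-split I))) ⟩
    ℤ.+ (inv ℕ.+ k) ℤ.- ℤ.+ k
      ≡⟨ trans (ℤₚ.[+m]-[+n]≡m⊖n (inv ℕ.+ k) k) (ℤₚ.⊖-≥ (ℕₚ.m≤n+m k inv)) ⟩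
    ℤ.+ (inv ℕ.+ k ℕ.∸ k)
      ≡⟨ cong ℤ.+_ (ℕₚ.m+n∸n≡m inv k) ⟩
    ℤ.+ inv ∎
    where
    open ≡-Reasoning
    k = suc ∣ I ∣ C 2
    inv = inversionCount (positions I ++ positions (∁ I))

  inversions-split : ∀ {n} (I : Subset n) →
    inversions (elems I ++ elems (∁ I)) ≡ inversionCount (positions I ++ positions (∁ I))
  inversions-split I = trans (inversions-toℕ (elems I ++ elems (∁ I)))
    (cong inversionCount (map-++ toℕ (elems I) (elems (∁ I))))

-- Transfer of signs from the twisted matrix to the original one

module Signs (ℝ : RealField) where
  open RealField ℝ hiding (_-_)
  open Reals ℝ
  open OrderedField ℝ
  open Pfaffian ℝ
  open Positivity ℝ
  open Reduction ℝ
  open Subsets ℝ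
  open ≡-Reasoning
  open +-*-Solver using () renaming (_:+_ to _⊹_; _:*_ to _⊛_; con to con′; solve to ℕ-solve; _:=_ to _≋_)

  hasSign-neg : ∀ {x s} → HasSign x s → HasSign (- x) (ℤ.- s)
  hasSign-neg (inj₁ (refl , 0<x))        = inj₂ (inj₂ (refl , -pos⇒neg (subst (0# <_) (sym (-‿involutive _)) 0<x)))
  hasSign-neg (inj₂ (inj₁ (refl , x≡0))) = inj₂ (inj₁ (refl , trans (cong (-_) x≡0) -0#≈0#))
  hasSign-neg (inj₂ (inj₂ (refl , x<0))) = inj₁ (refl , neg⇒-pos x<0)

  hasSign-neg1^ : ∀ k {x} → 0# < x → HasSign (neg1^ k * x) (neg1^ℤ (ℤ.+ k))
  hasSign-neg1^ zero    0<x = inj₁ (refl , subst (0# <_) (sym (*-idˡ _)) 0<x)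
  hasSign-neg1^ (suc k) {x} 0<x = subst (λ y → HasSign y (neg1^ℤ (ℤ.+ suc k))) (-‿distribˡ-* (neg1^ k) x)
    (hasSign-neg (hasSign-neg1^ k 0<x))

  module _ {n : ℕ} (A : Mat n n) (B : Matrix)
           (entries : ∀ a c → A a c ≡ neg1^ (suc (toℕ a ℕ.+ toℕ c)) * B (toℕ a) (toℕ c)) where

    -- Each of the `m` pairs contributes (-1)^{1+a+b} and each index lies in one pair, so the total
    -- sign depends on the index set alone and leaves the sum over `σ`.
    pairProd-twist : ∀ m σ → length σ ≡ m ℕ.* 2 →
      pairProd A σ ≡ neg1^ (sum (map toℕ σ) ℕ.+ m) * matching B (map toℕ σ)
    pairProd-twist zero    []          eq = sym (*-idˡ _)
    pairProd-twist (suc m) (a ∷ b ∷ r) eq = begin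
      A a b * pairProd A r
        ≡⟨ cong₂ _*_ (entries a b) (pairProd-twist m r (ℕₚ.suc-injective (ℕₚ.suc-injective eq))) ⟩
      (neg1^ (suc (i ℕ.+ j)) * B i j) * (neg1^ (s ℕ.+ m) * matching B (map toℕ r))
        ≡⟨ solve 4 (λ p x q y → (p :* x) :* (q :* y) := (p :* q) :* (x :* y)) refl _ _ _ _ ⟩
      (neg1^ (suc (i ℕ.+ j)) * neg1^ (s ℕ.+ m)) * (B i j * matching B (map toℕ r))
        ≡⟨ cong (_* (B i j * matching B (map toℕ r))) (trans (sym (neg1^-+ (suc (i ℕ.+ j)) (s ℕ.+ m))) (cong neg1^ exponent)) ⟩
      neg1^ ((i ℕ.+ (j ℕ.+ s)) ℕ.+ suc m) * (B i j * matching B (map toℕ r)) ∎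
      where
      i = toℕ a
      j = toℕ b
      s = sum (map toℕ r)
      exponent : suc (i ℕ.+ j) ℕ.+ (s ℕ.+ m) ≡ (i ℕ.+ (j ℕ.+ s)) ℕ.+ suc m
      exponent = ℕ-solve 4 (λ i j s m → (con′ 1 ⊹ (i ⊹ j)) ⊹ (s ⊹ m) ≋ (i ⊹ (j ⊹ s)) ⊹ (con′ 1 ⊹ m)) refl i j s m

    signedSum : ∀ m L → length L ≡ m ℕ.* 2 →
      sumList (map (λ σ → neg1^ (inversions σ) * pairProd A σ) (perms L))
      ≡ neg1^ (sum (map toℕ L) ℕ.+ m) * pf B (map toℕ L)
    signedSum m L ∣L∣ = begin
      sumList (map (λ σ → neg1^ (inversions σ) * pairProd A σ) (perms L))
        ≡⟨ sumList-perms L _ ⟩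
      permΣ L (λ σ → neg1^ (inversions σ) * pairProd A σ)
        ≡⟨ permΣ-cong L (λ σ p → trans
             (cong₂ _*_ (cong neg1^ (inversions-toℕ σ)) (trans (pairProd-twist m σ (trans (↭-length p) ∣L∣))
               (cong (λ s → neg1^ (s ℕ.+ m) * matching B (map toℕ σ)) (sum-↭ (↭ₚ.map⁺ toℕ p)))))
             (solve 3 (λ x c y → x :* (c :* y) := c :* (x :* y)) refl _ _ _)) ⟩
      permΣ L (λ σ → c * (sgn (map toℕ σ) * matching B (map toℕ σ)))
        ≡⟨ permΣ-* L c _ ⟩
      c * permΣ L (λ σ → sgn (map toℕ σ) * matching B (map toℕ σ))
        ≡⟨ cong (c *_) (sym (permΣ-map toℕ L _)) ⟩
      c * pf B (map toℕ L) ∎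
      where c = neg1^ (sum (map toℕ L) ℕ.+ m)

    -- For the 0-based sum s, s + 2m is the 1-based sum and equals inv + m + 2m² by
    -- `inversionCount-split`; cancelling one `m` leaves s + m = inv + 2m², and 2m² is even.
    neg1^-exponent : ∀ (I : Subset n) m → ∣ I ∣ ≡ m ℕ.* 2 →
      neg1^ (sum (positions I) ℕ.+ m) ≡ neg1^ (inversionCount (positions I ++ positions (∁ I)))
    neg1^-exponent I m ∣I∣ = begin
      neg1^ (sum (positions I) ℕ.+ m)                 ≡⟨ cong neg1^ (ℕₚ.+-cancelʳ-≡ m (sum (positions I) ℕ.+ m) (inv ℕ.+ (m ℕ.* m ℕ.+ m ℕ.* m)) exponent) ⟩
      neg1^ (inv ℕ.+ (m ℕ.* m ℕ.+ m ℕ.* m))           ≡⟨ trans (neg1^-+ inv (m ℕ.* m ℕ.+ m ℕ.* m)) (cong (neg1^ inv *_) (trans (neg1^-+ (m ℕ.* m) (m ℕ.* m)) (neg1^-square (m ℕ.* m)))) ⟩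
      neg1^ inv * 1#                                  ≡⟨ *-identityʳ _ ⟩
      neg1^ inv                                       ∎
      where
      inv = inversionCount (positions I ++ positions (∁ I))
      exponent : sum (positions I) ℕ.+ m ℕ.+ m ≡ inv ℕ.+ (m ℕ.* m ℕ.+ m ℕ.* m) ℕ.+ m
      exponent = begin
        sum (positions I) ℕ.+ m ℕ.+ m
          ≡⟨ ℕ-solve 2 (λ s m → s ⊹ m ⊹ m ≋ s ⊹ m ⊛ con′ 2) refl (sum (positions I)) m ⟩
        sum (positions I) ℕ.+ m ℕ.* 2
          ≡⟨ cong (sum (positions I) ℕ.+_) (sym (trans (length-positions I) ∣I∣)) ⟩
        sum (positions I) ℕ.+ length (positions I)
          ≡⟨ sym (sum-map-suc (positions I)) ⟩
        sum (map suc (positions I))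
          ≡⟨ sym (inversionCount-split I) ⟩
        inv ℕ.+ suc ∣ I ∣ C 2
          ≡⟨ cong (inv ℕ.+_) (trans (cong (λ k → suc k C 2) ∣I∣) ([1+2m]C2 m)) ⟩
        inv ℕ.+ (m ℕ.+ (m ℕ.* m ℕ.+ m ℕ.* m))
          ≡⟨ ℕ-solve 2 (λ i m → i ⊹ (m ⊹ (m ⊛ m ⊹ m ⊛ m)) ≋ i ⊹ (m ⊛ m ⊹ m ⊛ m) ⊹ m) refl inv m ⟩
        inv ℕ.+ (m ℕ.* m ℕ.+ m ℕ.* m) ℕ.+ m ∎

    Pf-sign : Run n (word n) zeroMatrix B → ∀ I → 2 ∣ ∣ I ∣ →
      HasSign (Pf I A) (neg1^ℤ (ℤ.+ inversionCount (positions I ++ positions (∁ I))))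
    Pf-sign r I (divides m ∣I∣) = subst (λ x → HasSign x (neg1^ℤ (ℤ.+ inv))) (sym Pf≡)
      (hasSign-neg1^ inv (*-pos (⁻¹-pos c-pos) pf-pos))
      where
      l = positions I
      inv = inversionCount (l ++ positions (∁ I))
      h = ⌊ length (elems I) /2⌋
      c = fromℕ (2 ^ h ℕ.* h !)
      c-pos : 0# < c
      c-pos = subst (λ k → 0# < fromℕ k) (ℕₚ.suc-pred (2 ^ h ℕ.* h !)
        {{ℕₚ.m*n≢0 (2 ^ h) (h !) {{ℕₚ.m^n≢0 2 h}} {{h ℕₚ.!≢0}}}}) (fromℕ-pos (ℕ.pred (2 ^ h ℕ.* h !)))
      ∣l∣ : length l ≡ m ℕ.* 2
      ∣l∣ = trans (length-positions I) ∣I∣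
      pf-pos : PfPos B l
      -- `positions` ascends while positivity is known for descending lists; the reversal is a
      -- permutation and leaves `pf` unchanged.
      pf-pos = pfPos-↭ B (↭ₚ.↭-reverse l) (word-pos n r {m} (trans (↭-length (↭ₚ.↭-reverse l)) ∣l∣)
        (reverse-descending (positions-ascending I)) (All-resp-↭ (↭-sym (↭ₚ.↭-reverse l)) (positions-bounded I)))
      Pf≡ : Pf I A ≡ neg1^ inv * (c ⁻¹ * pf B l)
      Pf≡ = trans (cong (c ⁻¹ *_) (trans (signedSum m (elems I) (trans (sym (length-map toℕ (elems I))) ∣l∣))
          (cong (_* pf B l) (neg1^-exponent I m ∣I∣))))
        (solve 3 (λ x y z → x :* (y :* z) := y :* (x :* z)) refl _ _ _)

open import Data.Integer using (+_; _-_)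

theorem1p7 : (ℝ : RealField) → let open Reals ℝ in
    (n : ℕ) (A : Mat n n) → TotallyPositive A →
    (I : Subset n) → 2 ∣ ∣ I ∣ →
    HasSign (Pf I A) (neg1^ℤ (+ sumIdx (map (λ i → suc (toℕ i)) (elems I)) - + ((suc ∣ I ∣) C 2)))
    × neg1^ℤ (+ inversions (elems I ++ elems (∁ I)))
    ≡ neg1^ℤ (+ sumIdx (map (λ i → suc (toℕ i)) (elems I)) - + ((suc ∣ I ∣) C 2))
theorem1p7 ℝ n A tp I even with Reduction.totallyPositive⇒run ℝ A tp
... | B , r , entries =
    subst (λ e → Reals.HasSign ℝ (Reals.Pf ℝ I A) (neg1^ℤ e)) (sym exponent) (Signs.Pf-sign ℝ A B entries r I even)
  , cong neg1^ℤ (trans (cong +_ (Subsets.inversions-split ℝ I)) (sym exponent))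
  where exponent = Subsets.index-exponent ℝ I
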